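{- Let $K\ge1$. Suppose $S$ is a finite symmetric subset of a group containing the identity, and $|S^{2n}|\le K|S^n|$ for some integer $n\ge 2K^2$. Then $|S^{3n}|\le K^3(3^9K^{18})^{10\cdot5^{K^2}}|S^n|$, and $S^{2n}$ is a $K^9(3^9K^{18})^{30\cdot5^{K^2}}$-approximate group.
   Context: For a set $S$ and integer $m\ge1$, $S^m=\{s_1\cdots s_m: s_i\in S\}$. A set $S$ is symmetric if $S=S^{ -1}$. For $L\ge1$, an $L$-approximate group is a symmetric subset $A$ of a group containing the identity such that $A^2$ is covered by at most $L$ left translates $xA$ of $A$.
   Formalization: The constant K ≥ 1 is taken rational instead of real; the real case follows by applying the result to the rational number |S^{2n}|/|S^n|, which is at least 1 and at most K. -}

module Defs where

open import Level using (Level; _⊔_)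
open import Algebra.Bundles using (Group)
open import Data.Nat as ℕ using (ℕ; zero; suc)
open import Data.Integer as ℤ using (ℤ; +_)
open import Data.Rational as ℚ using (ℚ; ↥_; ↧ₙ_; 0ℚ; 1ℚ; _/_)
open import Data.Fin using (Fin; zero; suc)
open import Data.List using (List)
open import Data.List.Relation.Unary.Any using (Any)
open import Data.Product using (Σ; _×_)
open import Relation.Binary.PropositionalEquality using (_≡_)

ℕ→ℚ : ℕ → ℚ
ℕ→ℚ n = (+ n) / 1

infixr 8 _^_
_^_ : ℚ → ℕ → ℚ
q ^ zero  = 1ℚ
q ^ suc m = q ℚ.* (q ^ m)

base : ℚ → ℚ
base K = (ℕ→ℚ 3 ^ 9) ℚ.* (K ^ 18)

-- For a rational t, "t ≥ e₀ · 5^(K²)" (a real-number inequality).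
-- Writing K² = a / b (a = |numerator|, b = denominator, K² ≥ 0), for t ≥ 0
-- this is equivalent to  e₀^b · 5^a ≤ t^b.
ExpGE : ℕ → ℚ → ℚ → Set
ExpGE e₀ K t =
  (0ℚ ℚ.≤ t) ×
  ((ℕ→ℚ e₀ ^ ↧ₙ s) ℚ.* (ℕ→ℚ 5 ^ ℤ.∣ ↥ s ∣) ℚ.≤ t ^ ↧ₙ s)
  where s = K ℚ.* K

-- For X, c ≥ 0, B ≥ 1 and rational t = p / d ≥ 0:
-- "X ≤ c · B^t"  ⇔  X^d ≤ c^d · B^p.
PowBound : ℚ → ℚ → ℚ → ℚ → Set
PowBound X c B t = X ^ ↧ₙ t ℚ.≤ (c ^ ↧ₙ t) ℚ.* (B ^ ℤ.∣ ↥ t ∣)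

-- BoundLe X c e₀ K  is the real-number inequality
--     X ≤ c · (3^9 K^18)^(e₀ · 5^(K²)).
-- Since the base is ≥ 1 (for K ≥ 1), B^e = inf { B^t : t rational, t ≥ e },
-- so this holds iff  X ≤ c · B^t  for every rational t ≥ e₀ · 5^(K²).
BoundLe : ℚ → ℚ → ℕ → ℚ → Set
BoundLe X c e₀ K = ∀ t → ExpGE e₀ K t → PowBound X c (base K) t

module GroupDefs {c ℓ : Level} (G : Group c ℓ) where
  open Group G

  Subset : Set (Level.suc (c ⊔ ℓ))
  Subset = Carrier → Set (c ⊔ ℓ)

  InList : List Carrier → Subset
  InList S x = Any (x ≈_) S

  prod : ∀ {m} → (Fin m → Carrier) → Carrier
  prod {zero}  s = ε
  prod {suc m} s = s zero ∙ prod (λ i → s (suc i))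

  Pow : Subset → ℕ → Subset
  Pow A m x = Σ (Fin m → Carrier) λ s → (∀ i → A (s i)) × (prod s ≈ x)

  Inv : Subset → Subset
  Inv A y = Σ Carrier λ x → A x × (y ≈ x ⁻¹)

  Symmetric : Subset → Set (c ⊔ ℓ)
  Symmetric A = ∀ y → ((A y → Inv A y) × (Inv A y → A y))

  HasCard : Subset → ℕ → Set (c ⊔ ℓ)
  HasCard A k =
    Σ (Fin k → Carrier) λ v →
      (∀ i j → v i ≈ v j → i ≡ j) ×
      (∀ i → A (v i)) ×
      (∀ x → A x → Σ (Fin k) λ i → x ≈ v i)

  -- A is an L-approximate group, where "k ≤ L" is expressed by the
  -- predicate  ok k  on the number k of translates:
  -- A symmetric, ε ∈ A, and A² ⊆ x₁A ∪ ⋯ ∪ x_k A with ok k.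
  IsApproxGroup : Subset → (ℕ → Set) → Set (c ⊔ ℓ)
  IsApproxGroup A ok =
    Symmetric A × A ε ×
    Σ ℕ λ k → ok k ×
      Σ (Fin k → Carrier) λ xs →
        ∀ y → Pow A 2 y → Σ (Fin k) λ i → Σ Carrier λ a → A a × (y ≈ xs i ∙ a)

{-# OPTIONS --safe #-}

-- Write B = Sⁿ, and let H be the set of those g for which B ∩ g B contains at
-- least |B| / 2k elements.  Choosing x₁, x₂, … in B as long as x B meets the
-- union of the earlier translates in at most half of its elements gives at most
-- k ≤ 2K centres with B ⊆ ⋃ xᵢ H.  Colour B by centres, and merge two colours
-- (tripling the diameter, measured in factors from H) whenever left
-- multiplication by an element of B fails to respect the colouring.  This ends
-- after at most k - 1 ≤ K² mergers, with diameter D ≤ 2 · 3^(k-1).  By pigeonhole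
-- on the suffixes of a word, every element of Sⁿ then has the colour of an
-- element of Sⁱ with i ≤ k - 1 ≤ n / 2, so Sⁿ ⊆ Sⁱ H^D, and iterating gives
-- S⁴ⁿ ⊆ Sⁱ H^(7D).  Each factor from H has |B| / 2k representations p q⁻¹ with
-- p, q in B; regrouping a product of m factors into elements of B B bounds a
-- family of translates of B with no visible overlap, whence S⁴ⁿ is covered by
-- at most K (4K²)^(7D) translates of S²ⁿ.
--
-- Equality is decidable only between elements of S²ⁿ, so every search and every
-- maximal family is phrased in terms of the multiplication table Sⁿ × Sⁿ → S²ⁿ.

module Submission where

open import Defs
import Level
open import Algebra.Bundles using (Group)
import Algebra.Properties.Group as GroupProperties
open import Data.Nat as ℕ using (ℕ; zero; suc)
open import Data.Nat.Coprimality using (1-coprimeTo) renaming (sym to coprime-sym)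
open import Data.Nat.Induction using (<-wellFounded)
open import Data.Nat.ListAction using (sum)
import Data.Nat.Properties as ℕP
open import Data.Nat.Tactic.RingSolver using (solve-∀)
import Data.Integer as ℤ
import Data.Integer.Properties as ℤP
open import Data.Rational as ℚ using (ℚ)
import Data.Rational.Properties as ℚP
open import Data.Rational.Solver using (module +-*-Solver)
open import Data.Fin using (Fin; zero; suc; toℕ; combine; remQuot; punchOut)
open import Data.Fin.Properties as FinP
  using (injective⇒≤; any?; pigeonhole; combine-injective; combine-remQuot; punchOut-injective)
open import Data.List using (List; []; _∷_; _++_; length; map; filter; lookup; tabulate; allFin; cartesianProduct)
open import Data.List.Membership.Propositional using (_∈_)
open import Data.List.Membership.Propositional.Properties
  using (∈-filter⁺; ∈-filter⁻; ∈-++⁺ˡ; ∈-++⁺ʳ; ∈-++⁻; ∈-lookup; ∈-tabulate⁻; ∈-allFin; ∈-cartesianProduct⁺)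
import Data.List.Membership.DecPropositional as DecMembership
open import Data.List.Properties using (length-++; length-tabulate; filter-none)
open import Data.List.Relation.Binary.Sublist.Propositional using (_⊆_; ⊆-refl)
import Data.List.Relation.Binary.Sublist.Propositional.Properties as Sublist
open import Data.List.Relation.Unary.All as All using (All; []; _∷_)
open import Data.List.Relation.Unary.AllPairs using ([]; _∷_)
open import Data.List.Relation.Unary.Any as Any using (Any; here; there)
open import Data.List.Relation.Unary.Any.Properties using (lookup-index)
open import Data.List.Relation.Unary.Unique.Propositional using (Unique)
import Data.List.Relation.Unary.Unique.Propositional.Properties as Unique
open import Data.Product using (Σ; ∃; ∃₂; _×_; _,_; proj₁; proj₂; uncurry)
open import Data.Sum using (_⊎_; inj₁; inj₂)
open import Data.Vec as Vec using (Vec; []; _∷_)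
import Data.Vec.Properties as VecP
open import Function using (_∘_; id)
open import Induction.WellFounded using (Acc; acc)
open import Relation.Binary using (DecidableEquality)
open import Relation.Binary.PropositionalEquality as ≡ using (_≡_; _≢_; cong; cong₂; subst; subst₂)
import Relation.Binary.Reasoning.Setoid as SetoidReasoning
open import Relation.Nullary using (¬_; Dec; yes; no; ¬?; contradiction)
open import Relation.Nullary.Decidable using (_×-dec_; decidable-stable; toWitness)
open import Relation.Unary using (Pred; Decidable)

-- Averaging, duplicate-free lists and greedy maximal families.

module Counting where
  open import Data.Nat using (_+_; _*_; _≤_; _<_; z≤n; s≤s; _<?_)
  open import Relation.Binary.PropositionalEquality using (refl; sym; trans)

  module _ {p q} {E : Set} {P : Pred E p} {Q : Pred E q} (P? : Decidable P) (Q? : Decidable Q) where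

    length-filter-mono : (∀ {x} → P x → Q x) → ∀ xs →
                         length (filter P? xs) ≤ length (filter Q? xs)
    length-filter-mono P⇒Q xs =
      Sublist.length-mono-≤ (Sublist.filter⁺ P? Q? (λ { refl → P⇒Q }) (⊆-refl {x = xs}))

  length-filter-⊆ : ∀ {p} {E : Set} {P : Pred E p} (P? : Decidable P) {xs ys} → xs ⊆ ys →
                    length (filter P? xs) ≤ length (filter P? ys)
  length-filter-⊆ P? = Sublist.length-mono-≤ ∘ Sublist.filter⁺ P? P? (λ { refl → id })

  length-filter-split : ∀ {p} {E : Set} {P : Pred E p} (P? : Decidable P) xs →
                        length xs ≡ length (filter P? xs) + length (filter (¬? ∘ P?) xs)
  length-filter-split P? [] = refl
  length-filter-split P? (x ∷ xs) with P? x
  ... | yes _ = cong suc (length-filter-split P? xs)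
  ... | no  _ = trans (cong suc (length-filter-split P? xs)) (sym (ℕP.+-suc _ _))

  lookup-injective : ∀ {E : Set} {xs : List E} → Unique xs → ∀ {i j} → lookup xs i ≡ lookup xs j → i ≡ j
  lookup-injective (_ ∷ _)   {zero}  {zero}  _  = refl
  lookup-injective (x∉ ∷ _)  {zero}  {suc j} eq = contradiction eq (All.lookup x∉ (∈-lookup j))
  lookup-injective (x∉ ∷ _)  {suc i} {zero}  eq = contradiction (sym eq) (All.lookup x∉ (∈-lookup i))
  lookup-injective (_ ∷ uxs) {suc i} {suc j} eq = cong suc (lookup-injective uxs eq)

  length-unique-≤ : ∀ {E : Set} {N} (f : E → Fin N) → (∀ {x y} → f x ≡ f y → x ≡ y) →
                    ∀ {xs} → Unique xs → length xs ≤ N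
  length-unique-≤ f f-inj {xs} uxs =
    injective⇒≤ {f = f ∘ lookup xs} (lookup-injective uxs ∘ f-inj)

  -- Averaging by induction: a head with `k * f c ≤ N` uses no more than its share `N`, so the
  -- strict inequality survives on the tail.
  some-term-exceeds-mean : ∀ {C : Set} (f : C → ℕ) N k X → N * length X < k * sum (map f X) →
                           Any (λ c → N < k * f c) X
  some-term-exceeds-mean f N k []      lt rewrite ℕP.*-zeroʳ k = contradiction lt λ ()
  some-term-exceeds-mean f N k (c ∷ X) lt with N <? k * f c
  ... | yes N<kf = here N<kf
  ... | no  N≮kf = there (some-term-exceeds-mean f N k X (ℕP.+-cancelˡ-< N _ _ (begin-strict
      N + N * length X           ≡⟨ ℕP.*-suc N (length X) ⟨
      N * suc (length X)         <⟨ lt ⟩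
      k * (f c + sum (map f X))  ≡⟨ ℕP.*-distribˡ-+ k (f c) _ ⟩
      k * f c + k * sum (map f X) ≤⟨ ℕP.+-monoˡ-≤ _ (ℕP.≮⇒≥ N≮kf) ⟩
      N + k * sum (map f X)      ∎)))
    where open ℕP.≤-Reasoning

  module Greedy {C E : Set} (_≟_ : DecidableEquality E) (T : C → List E) where

    open DecMembership _≟_ using (_∈?_)

    meet : List E → List E → List E
    meet U L = filter (_∈? U) L

    diff : List E → List E → List E
    diff U L = filter (¬? ∘ (_∈? U)) L

    -- A chosen family X whose union of the T c is U, every member of which
    -- contributed at least W / d new points when it was added.
    record Family (d W : ℕ) (cs : List C) : Set where
      field
        X         : List C
        U         : List E
        unique    : Unique U
        covered   : ∀ {t} → t ∈ U → Any (λ c → t ∈ T c) X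
        size      : length X * W ≤ length U * d
        saturated : ∀ {c} → c ∈ cs → length (diff U (T c)) * d < W

    -- Candidates are treated from the end of the list and kept when they contribute enough. Later
    -- additions only enlarge `U`, so `diff` shrinks and saturation persists.
    greedy : ∀ d {W} → 0 < W → (∀ c → Unique (T c)) → ∀ cs → Family d W cs
    greedy d 0<W uniq [] = record
      { X = [] ; U = [] ; unique = [] ; covered = λ () ; size = z≤n ; saturated = λ () }
    greedy d {W} 0<W uniq (c ∷ cs) = extend (length (diff U (T c)) * d <? W)
      where
      F = greedy d 0<W uniq cs
      open Family F
      new = diff U (T c)
      open ℕP.≤-Reasoning

      extend : Dec (length new * d < W) → Family d W (c ∷ cs)
      extend (yes lt) = record
        { X = X ; U = U ; unique = unique ; covered = covered ; size = size
        ; saturated = λ { (here refl) → lt ; (there c∈) → saturated c∈ } }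
      extend (no ≥W) = record
        { X = c ∷ X
        ; U = new ++ U
        ; unique = Unique.++⁺ (Unique.filter⁺ _ (uniq c)) unique
                     λ { (t∈new , t∈U) → proj₂ (∈-filter⁻ _ {xs = T c} t∈new) t∈U }
        ; covered = λ t∈ → case-covered (∈-++⁻ new t∈)
        ; size = begin
            W + length X * W                 ≤⟨ ℕP.+-mono-≤ (ℕP.≮⇒≥ ≥W) size ⟩
            length new * d + length U * d    ≡⟨ ℕP.*-distribʳ-+ d (length new) (length U) ⟨
            (length new + length U) * d      ≡⟨ cong (_* d) (length-++ new) ⟨
            length (new ++ U) * d            ∎
        -- A candidate just added has no points outside the new union; `0<W` turns this into
        -- saturation.
        ; saturated = λ { (here refl) → subst (λ l → length l * d < W) (sym exhausted) 0<W
                        ; {c′} (there c∈) → ℕP.≤-<-trans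
                            (ℕP.*-monoˡ-≤ d (length-filter-mono _ _ (λ ∉ ∈U → ∉ (∈-++⁺ʳ new ∈U)) (T c′)))
                            (saturated c∈) } }
        where
        case-covered : ∀ {t} → t ∈ new ⊎ t ∈ U → Any (λ c′ → t ∈ T c′) (c ∷ X)
        case-covered (inj₁ t∈new) = here (proj₁ (∈-filter⁻ _ {xs = T c} t∈new))
        case-covered (inj₂ t∈U)   = there (covered t∈U)

        exhausted : diff (new ++ U) (T c) ≡ []
        exhausted = filter-none (¬? ∘ (_∈? (new ++ U))) {xs = T c} (All.tabulate λ {t} t∈ t∉ → t∉ (locate t∈ (t ∈? U)))
          where
          locate : ∀ {t} → t ∈ T c → Dec (t ∈ U) → t ∈ new ++ U
          locate t∈ (yes t∈U) = ∈-++⁺ʳ new t∈U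
          locate t∈ (no t∉U)  = ∈-++⁺ˡ (∈-filter⁺ _ t∈ t∉U)

    sum-meets-mono : ∀ {L L′} → L ⊆ L′ → ∀ X → sum (map (λ c → length (meet (T c) L)) X) ≤
                                               sum (map (λ c → length (meet (T c) L′)) X)
    sum-meets-mono L⊆L′ []      = z≤n
    sum-meets-mono L⊆L′ (c ∷ X) = ℕP.+-mono-≤ (length-filter-⊆ (_∈? T c) L⊆L′) (sum-meets-mono L⊆L′ X)

    -- Union bound: the points of `L` in `T c` are counted by the first summand, and the others must
    -- be covered by the tail, whose meets only grow when `rest` is enlarged to `L`.
    length≤sum-meets : ∀ X L → All (λ t → Any (λ c → t ∈ T c) X) L →
                       length L ≤ sum (map (λ c → length (meet (T c) L)) X)
    length≤sum-meets []      []      []       = z≤n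
    length≤sum-meets []      (_ ∷ _) (() ∷ _)
    length≤sum-meets (c ∷ X) L       cov      = begin
      length L                                                  ≡⟨ length-filter-split (_∈? T c) L ⟩
      length (meet (T c) L) + length rest                       ≤⟨ ℕP.+-monoʳ-≤ _ (length≤sum-meets X rest cov′) ⟩
      length (meet (T c) L) + sum (map (λ c′ → length (meet (T c′) rest)) X)
        ≤⟨ ℕP.+-monoʳ-≤ _ (sum-meets-mono (Sublist.filter-⊆ _ L) X) ⟩
      length (meet (T c) L) + sum (map (λ c′ → length (meet (T c′) L)) X) ∎
      where
      open ℕP.≤-Reasoning
      rest = diff (T c) L

      cov′ : All (λ t → Any (λ c′ → t ∈ T c′) X) rest
      cov′ = All.tabulate λ t∈ → let t∈L , t∉ = ∈-filter⁻ _ {xs = L} t∈ in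
        skip t∉ (All.lookup cov t∈L)
        where
        skip : ∀ {t} → ¬ t ∈ T c → Any (λ c′ → t ∈ T c′) (c ∷ X) → Any (λ c′ → t ∈ T c′) X
        skip t∉ (here t∈)  = contradiction t∈ t∉
        skip t∉ (there an) = an

    module _ {d W cs} (F : Family d W cs) where
      open Family F
      open ℕP.≤-Reasoning

      -- Were `T c` disjoint from `U`, then `diff U (T c)` would be all of `T c`, too long for a
      -- saturated candidate.
      meets-union : ∀ {c} → c ∈ cs → W ≤ length (T c) * d → ∃ λ t → t ∈ T c × t ∈ U
      meets-union {c} c∈ W≤ = search (T c) id
        (λ none → ℕP.<⇒≱ (saturated c∈) (subst (λ l → W ≤ length l * d) (sym none) W≤))
        where
        search : ∀ L → (∀ {t} → t ∈ L → t ∈ T c) → ¬ (diff U L ≡ L) → ∃ λ t → t ∈ T c × t ∈ U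
        search []      _   ne = contradiction refl ne
        search (t ∷ L) sub ne with t ∈? U
        ... | yes t∈U = t , sub (here refl) , t∈U
        ... | no  _   = search L (sub ∘ there) (ne ∘ cong (t ∷_))

    module _ {W cs} (F : Family 2 W cs) where
      open Family F

      -- With `d = 2`, saturation puts more than half of `T c` inside `U`; averaging over the
      -- members of `X` finds one with more than `W / (2 * length X)` points in common with `T c`.
      popular-member : ∀ {c} → c ∈ cs → length (T c) ≡ W →
                       Any (λ x → W < (2 * length X) * length (meet (T x) (T c))) X
      popular-member {c} c∈ refl = some-term-exceeds-mean (λ x → length (meet (T x) (T c))) W (2 * length X) X
        (scale X (ℕP.<-≤-trans more-than-half (ℕP.*-monoʳ-≤ 2 (length≤sum-meets X (meet U (T c))
          (All.tabulate λ t∈ → covered (proj₂ (∈-filter⁻ _ {xs = T c} t∈)))))))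
        where
        open ℕP.≤-Reasoning
        more-than-half : W < 2 * length (meet U (T c))
        more-than-half = ℕP.+-cancelʳ-< (2 * length (diff U (T c))) _ _ (begin-strict
          W + 2 * length (diff U (T c))  ≡⟨ cong (W +_) (ℕP.*-comm 2 (length (diff U (T c)))) ⟩
          W + length (diff U (T c)) * 2  <⟨ ℕP.+-monoʳ-< W (saturated c∈) ⟩
          W + W                          ≡⟨ cong (W +_) (ℕP.+-identityʳ W) ⟨
          2 * W                          ≡⟨ cong (2 *_) (length-filter-split (_∈? U) (T c)) ⟩
          2 * (length (meet U (T c)) + length (diff U (T c)))      ≡⟨ ℕP.*-distribˡ-+ 2 (length (meet U (T c))) _ ⟩
          2 * length (meet U (T c)) + 2 * length (diff U (T c))    ∎)

        -- Multiplication by `length Y` stays strict for non-empty `Y`; for the empty list the sum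
        -- is 0 and the hypothesis is absurd.
        scale : ∀ Y → W < 2 * sum (map (λ x → length (meet (T x) (meet U (T c)))) Y) →
                W * length Y < (2 * length Y) * sum (map (λ x → length (meet (T x) (T c))) Y)
        scale []        lt = contradiction lt λ ()
        scale Y@(_ ∷ Y′) lt = begin-strict
          W * length Y           <⟨ ℕP.*-monoˡ-< (length Y) lt ⟩
          (2 * m) * length Y     ≡⟨ ℕP.*-assoc 2 m _ ⟩
          2 * (m * length Y)     ≡⟨ cong (2 *_) (ℕP.*-comm m _) ⟩
          2 * (length Y * m)     ≡⟨ ℕP.*-assoc 2 (length Y) m ⟨
          (2 * length Y) * m     ≤⟨ ℕP.*-monoʳ-≤ (2 * length Y) (sum-meets-mono (Sublist.filter-⊆ _ (T c)) Y) ⟩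
          (2 * length Y) * _     ∎
          where m = sum (map (λ x → length (meet (T x) (meet U (T c)))) Y)

module Growth where
  open Counting
  open import Data.Nat using (_+_; _*_; _∸_; _≤_; _<_; z≤n; s≤s; _≤?_)

  -- Words over a subset of a group.

  module Words {c ℓ} (G : Group c ℓ) (A : GroupDefs.Subset G) where
    open Group G
    open GroupDefs G
    open GroupProperties G
    open SetoidReasoning setoid

    Pow-resp : ∀ {m x y} → x ≈ y → Pow A m x → Pow A m y
    Pow-resp x≈y (s , s∈ , eq) = s , s∈ , trans eq x≈y

    Pow-∙ : ∀ {j k x y} → Pow A j x → Pow A k y → Pow A (j + k) (x ∙ y)
    Pow-∙ {zero} (_ , _ , ε≈x) y∈ = Pow-resp (trans (sym (identityˡ _)) (∙-congʳ ε≈x)) y∈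
    Pow-∙ {suc j} {k} {x} {y} (s , s∈ , eq) y∈ = prepend (Pow-∙ {j} (s ∘ suc , s∈ ∘ suc , refl) y∈)
      where
      prepend : Pow A (j + k) (prod (s ∘ suc) ∙ y) → Pow A (suc (j + k)) (x ∙ y)
      prepend (t , t∈ , eq′) = (λ { zero → s zero ; (suc i) → t i })
                             , (λ { zero → s∈ zero ; (suc i) → t∈ i })
                             , (begin
        s zero ∙ prod t                    ≈⟨ ∙-congˡ eq′ ⟩
        s zero ∙ (prod (s ∘ suc) ∙ y)      ≈⟨ assoc _ _ _ ⟨
        (s zero ∙ prod (s ∘ suc)) ∙ y      ≈⟨ ∙-congʳ eq ⟩
        x ∙ y                              ∎)

    Pow-split : ∀ j {k x} → Pow A (j + k) x → ∃₂ λ y z → Pow A j y × Pow A k z × x ≈ y ∙ z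
    Pow-split zero {x = x} x∈ = ε , x , ((λ ()) , (λ ()) , refl) , x∈ , sym (identityˡ x)
    Pow-split (suc j) {x = x} (s , s∈ , eq) =
      let y , z , (t , t∈ , eq′) , z∈ , tail≈ = Pow-split j (s ∘ suc , s∈ ∘ suc , refl) in
      s zero ∙ y , z
      , ((λ { zero → s zero ; (suc i) → t i }) , (λ { zero → s∈ zero ; (suc i) → t∈ i }) , ∙-congˡ eq′)
      , z∈
      , (begin
        x                             ≈⟨ eq ⟨
        s zero ∙ prod (s ∘ suc)       ≈⟨ ∙-congˡ tail≈ ⟩
        s zero ∙ (y ∙ z)              ≈⟨ assoc _ _ _ ⟨
        (s zero ∙ y) ∙ z              ∎)

    Pow-split-suffix : ∀ {j t x} → t ≤ j → Pow A j x → ∃₂ λ y z → Pow A (j ∸ t) y × Pow A t z × x ≈ y ∙ z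
    Pow-split-suffix {j} {t} {x} t≤j x∈ =
      Pow-split (j ∸ t) (subst (λ l → Pow A l x) (≡.sym (ℕP.m∸n+n≡m t≤j)) x∈)

    Pow-1 : ∀ {x} → A x → Pow A 1 x
    Pow-1 {x} x∈ = (λ _ → x) , (λ _ → x∈) , identityʳ x

    module _ (ε∈A : A ε) where

      Pow-ε : ∀ m → Pow A m ε
      Pow-ε zero    = (λ ()) , (λ ()) , refl
      Pow-ε (suc m) = Pow-resp (identityˡ ε) (Pow-∙ (Pow-1 ε∈A) (Pow-ε m))

      Pow-mono : ∀ {j k x} → j ≤ k → Pow A j x → Pow A k x
      Pow-mono {j} {k} {x} j≤k x∈ = subst (λ l → Pow A l x) (ℕP.m∸n+n≡m j≤k)
        (Pow-resp (identityˡ x) (Pow-∙ (Pow-ε (k ∸ j)) x∈))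

    module _ (A-⁻¹ : ∀ {x} → A x → A (x ⁻¹)) where

      Pow-⁻¹ : ∀ {m x} → Pow A m x → Pow A m (x ⁻¹)
      Pow-⁻¹ {zero}  (s , s∈ , ε≈x) = s , s∈ , trans (sym ε⁻¹≈ε) (⁻¹-cong ε≈x)
      Pow-⁻¹ {suc m} {x} (s , s∈ , eq) = Pow-resp (begin
        prod (s ∘ suc) ⁻¹ ∙ s zero ⁻¹   ≈⟨ ⁻¹-anti-homo-∙ _ _ ⟨
        (s zero ∙ prod (s ∘ suc)) ⁻¹    ≈⟨ ⁻¹-cong eq ⟩
        x ⁻¹                            ∎)
        (subst (λ l → Pow A l (prod (s ∘ suc) ⁻¹ ∙ s zero ⁻¹)) (ℕP.+-comm m 1)
          (Pow-∙ (Pow-⁻¹ {m} (s ∘ suc , s∈ ∘ suc , refl)) (Pow-1 (A-⁻¹ (s∈ zero)))))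

      Pow-symmetric : ∀ m → Symmetric (Pow A m)
      Pow-symmetric m y = (λ y∈ → y ⁻¹ , Pow-⁻¹ y∈ , sym (⁻¹-involutive y))
                        , λ { (x , x∈ , y≈) → Pow-resp (sym y≈) (Pow-⁻¹ x∈) }

  -- Finite codes, gluing of colours, and an inequality for word lengths.

  encode : ∀ {b m} → Vec (Fin b) m → Fin (b ℕ.^ m)
  encode []       = zero
  encode (x ∷ xs) = combine x (encode xs)

  -- Together with `length-unique-≤`, this bounds a duplicate-free list of vectors by `b ℕ.^ m`.
  encode-injective : ∀ {b m} {xs ys : Vec (Fin b) m} → encode xs ≡ encode ys → xs ≡ ys
  encode-injective {xs = []}     {[]}     _  = ≡.refl
  encode-injective {xs = x ∷ xs} {y ∷ ys} eq =
    let x≡y , e = combine-injective x (encode xs) y (encode ys) eq in cong₂ _∷_ x≡y (encode-injective e)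

  -- `punchOut` deletes `α` from the range, and `α` itself is sent to the image of `β`.
  identify : ∀ {k} {α β : Fin (suc k)} → α ≢ β → Fin (suc k) → Fin k
  identify {α = α} α≢β x with α FinP.≟ x
  ... | yes _  = punchOut α≢β
  ... | no α≢x = punchOut α≢x

  identify-fibres : ∀ {k} {α β : Fin (suc k)} (α≢β : α ≢ β) x y → identify α≢β x ≡ identify α≢β y →
                    x ≡ y ⊎ (x ≡ α × y ≡ β) ⊎ (x ≡ β × y ≡ α)
  identify-fibres {α = α} α≢β x y eq with α FinP.≟ x | α FinP.≟ y
  ... | yes p | yes q  = inj₁ (≡.trans (≡.sym p) q)
  ... | yes p | no q   = inj₂ (inj₁ (≡.sym p , ≡.sym (punchOut-injective α≢β q eq)))
  ... | no p  | yes q  = inj₂ (inj₂ (punchOut-injective p α≢β eq , ≡.sym q))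
  ... | no p  | no q   = inj₁ (punchOut-injective p q eq)

  -- With `r = n ∸ κ` the hypothesis reads `κ ≤ r`, so 4r + 4κ is at most 7r + κ. This fixes the
  -- seven rounds of `spread`.
  4n≤7[n∸κ]+κ : ∀ {κ n} → κ ≤ n → 2 * κ ≤ n → 2 * n + 2 * n ≤ 7 * (n ∸ κ) + κ
  4n≤7[n∸κ]+κ {κ} {n} κ≤n 2κ≤n = begin
    2 * n + 2 * n                 ≡⟨ cong (λ n → 2 * n + 2 * n) κ+r≡n ⟨
    2 * (κ + r) + 2 * (κ + r)     ≡⟨ lhs κ r ⟩
    (4 * r + κ) + 3 * κ           ≤⟨ ℕP.+-monoʳ-≤ (4 * r + κ) (ℕP.*-monoʳ-≤ 3 κ≤r) ⟩
    (4 * r + κ) + 3 * r           ≡⟨ rhs κ r ⟩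
    7 * r + κ                     ∎
    where
    open ℕP.≤-Reasoning
    r = n ∸ κ
    κ+r≡n : κ + r ≡ n
    κ+r≡n = ℕP.m+[n∸m]≡n κ≤n
    κ≤r : κ ≤ r
    κ≤r = ℕP.+-cancelˡ-≤ κ κ r (begin
      κ + κ   ≡⟨ cong (κ +_) (ℕP.+-identityʳ κ) ⟨
      2 * κ   ≤⟨ 2κ≤n ⟩
      n       ≡⟨ κ+r≡n ⟨
      κ + r   ∎)
    lhs : ∀ k r → 2 * (k + r) + 2 * (k + r) ≡ (4 * r + k) + 3 * k
    lhs = solve-∀
    rhs : ∀ k r → (4 * r + k) + 3 * r ≡ 7 * r + k
    rhs = solve-∀

  -- The multiplication table of the ball, and elements with many representations.

  module Ball {c ℓ} (G : Group c ℓ) (A : GroupDefs.Subset G)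
    (A-⁻¹ : ∀ {x} → A x → A (Group._⁻¹ G x)) (ε∈A : A (Group.ε G))
    (n a b : ℕ)
    (cardA : GroupDefs.HasCard G (GroupDefs.Pow G A n) a)
    (cardB : GroupDefs.HasCard G (GroupDefs.Pow G A (2 ℕ.* n)) b)
    where

    open Group G
    open GroupDefs G
    open GroupProperties G
    open Words G A
    open SetoidReasoning setoid

    v : Fin a → Carrier
    v = proj₁ cardA

    v-injective : ∀ {i j} → v i ≈ v j → i ≡ j
    v-injective = proj₁ (proj₂ cardA) _ _

    v∈ : ∀ i → Pow A n (v i)
    v∈ = proj₁ (proj₂ (proj₂ cardA))

    index : ∀ {x} → Pow A n x → Fin a
    index x∈ = proj₁ (proj₂ (proj₂ (proj₂ cardA)) _ x∈)

    v-index : ∀ {x} (x∈ : Pow A n x) → v (index x∈) ≈ x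
    v-index x∈ = sym (proj₂ (proj₂ (proj₂ (proj₂ cardA)) _ x∈))

    w : Fin b → Carrier
    w = proj₁ cardB

    w-injective : ∀ {i j} → w i ≈ w j → i ≡ j
    w-injective = proj₁ (proj₂ cardB) _ _

    w∈ : ∀ i → Pow A (2 * n) (w i)
    w∈ = proj₁ (proj₂ (proj₂ cardB))

    Pow-∙₂ : ∀ {x y} → Pow A n x → Pow A n y → Pow A (2 * n) (x ∙ y)
    Pow-∙₂ {x} {y} x∈ y∈ = subst (λ l → Pow A l (x ∙ y)) (cong (n +_) (≡.sym (ℕP.+-identityʳ n))) (Pow-∙ x∈ y∈)

    mul : Fin a → Fin a → Fin b
    mul i j = proj₁ (proj₂ (proj₂ (proj₂ cardB)) (v i ∙ v j) (Pow-∙₂ (v∈ i) (v∈ j)))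

    w-mul : ∀ i j → w (mul i j) ≈ v i ∙ v j
    w-mul i j = sym (proj₂ (proj₂ (proj₂ (proj₂ cardB)) (v i ∙ v j) (Pow-∙₂ (v∈ i) (v∈ j))))

    mul-≡⇒≈ : ∀ {i j i′ j′} → mul i j ≡ mul i′ j′ → v i ∙ v j ≈ v i′ ∙ v j′
    mul-≡⇒≈ eq = trans (sym (w-mul _ _)) (trans (reflexive (cong w eq)) (w-mul _ _))

    mul-≈⇒≡ : ∀ {i j i′ j′} → v i ∙ v j ≈ v i′ ∙ v j′ → mul i j ≡ mul i′ j′
    mul-≈⇒≡ eq = w-injective (trans (w-mul _ _) (trans eq (sym (w-mul _ _))))

    mul-cancelˡ : ∀ i {j j′} → mul i j ≡ mul i j′ → j ≡ j′
    mul-cancelˡ i eq = v-injective (∙-cancelˡ _ _ _ (mul-≡⇒≈ eq))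

    inv : Fin a → Fin a
    inv i = index (Pow-⁻¹ A-⁻¹ (v∈ i))

    v-inv : ∀ i → v (inv i) ≈ v i ⁻¹
    v-inv i = v-index (Pow-⁻¹ A-⁻¹ (v∈ i))

    e : Fin a
    e = index (Pow-ε ε∈A n)

    0<a : 0 < a
    0<a = positive e
      where
      positive : ∀ {m} → Fin m → 0 < m
      positive zero    = s≤s z≤n
      positive (suc _) = s≤s z≤n

    -- An element g with at least a / K representations v p ∙ (v q)⁻¹.
    record Step (K : ℕ) : Set (c Level.⊔ ℓ) where
      field
        g              : Carrier
        num            : ℕ
        left right     : Fin num → Fin a
        represents     : ∀ i → v (left i) ≈ g ∙ v (right i)
        left-injective : ∀ {i j} → left i ≡ left j → i ≡ j
        popular        : a ≤ K * num

    open Step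

    module _ {K : ℕ} where

      -- For fixed `g`, each factor of a representation determines the other; hence the inverse of a
      -- step is again a step.
      right-injective : ∀ (h : Step K) {i j} → right h i ≡ right h j → i ≡ j
      right-injective h {i} {j} eq = left-injective h (v-injective (begin
        v (left h i)            ≈⟨ represents h i ⟩
        g h ∙ v (right h i)     ≈⟨ ∙-congˡ (reflexive (cong v eq)) ⟩
        g h ∙ v (right h j)     ≈⟨ represents h j ⟨
        v (left h j)            ∎))

      step-⁻¹ : Step K → Step K
      step-⁻¹ h = record
        { g = g h ⁻¹ ; num = num h ; left = right h ; right = left h
        ; represents = λ i → begin
            v (right h i)                    ≈⟨ \\-leftDividesʳ (g h) _ ⟨
            g h ⁻¹ ∙ (g h ∙ v (right h i))   ≈⟨ ∙-congˡ (represents h i) ⟨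
            g h ⁻¹ ∙ v (left h i)            ∎
        ; left-injective = right-injective h
        ; popular = popular h }

      hprod : ∀ {m} → Vec (Step K) m → Carrier
      hprod []       = ε
      hprod (h ∷ hs) = g h ∙ hprod hs

      hprod-++ : ∀ {m m′} (hs : Vec (Step K) m) (hs′ : Vec (Step K) m′) →
                 hprod (hs Vec.++ hs′) ≈ hprod hs ∙ hprod hs′
      hprod-++ []       hs′ = sym (identityˡ _)
      hprod-++ (h ∷ hs) hs′ = trans (∙-congˡ (hprod-++ hs hs′)) (sym (assoc _ _ _))

    Reach : ℕ → ℕ → Carrier → Set (c Level.⊔ ℓ)
    Reach K m x = Σ (Vec (Step K) m) λ hs → x ≈ hprod hs

    module _ {K : ℕ} where

      Reach-resp : ∀ {m x y} → x ≈ y → Reach K m x → Reach K m y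
      Reach-resp x≈y (hs , eq) = hs , trans (sym x≈y) eq

      Reach-∙ : ∀ {m m′ x y} → Reach K m x → Reach K m′ y → Reach K (m + m′) (x ∙ y)
      Reach-∙ (hs , eq) (hs′ , eq′) = hs Vec.++ hs′ , trans (∙-cong eq eq′) (sym (hprod-++ hs hs′))

      Reach-step : ∀ (h : Step K) → Reach K 1 (g h)
      Reach-step h = h ∷ [] , sym (identityʳ _)

    -- The diagonal gives `a` representations of the identity, so products of steps can be padded to
    -- any greater length.
    step-ε : ∀ {K} → 0 < K → Step K
    step-ε {K} K>0 = record
      { g = ε ; num = a ; left = id ; right = id
      ; represents = λ i → sym (identityˡ _) ; left-injective = id ; popular = ℕP.m≤n*m a K ⦃ ℕ.>-nonZero K>0 ⦄ }

    Reach-ε : ∀ {K} → 0 < K → ∀ m → Reach K m ε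
    Reach-ε K>0 zero    = [] , refl
    Reach-ε K>0 (suc m) = Reach-resp (identityˡ ε) (Reach-∙ (Reach-step (step-ε K>0)) (Reach-ε K>0 m))

    -- Centres and the initial colouring.

    translates : Fin a → List (Fin b)
    translates x = tabulate (mul x)

    open Greedy FinP._≟_ translates using (meet; popular-member) renaming
      (greedy to choose-centres; Family to Centres)

    translates-unique : ∀ x → Unique (translates x)
    translates-unique x = Unique.tabulate⁺ (mul-cancelˡ x)

    centres : Centres 2 a (allFin a)
    centres = choose-centres 2 0<a translates-unique (allFin a)

    open Greedy.Family centres using () renaming (X to C; size to C-size; unique to ∪C-unique)

    -- The constant supplied by `popular-member`: each translate shares more than `a / K` elements
    -- with that of some centre.
    K : ℕ
    K = 2 * length C

    -- A common element `v x ∙ v p ≈ v y ∙ v q` of the two translates represents `v x ⁻¹ ∙ v y` as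
    -- `v p ∙ v q ⁻¹`.
    overlap-step : ∀ x y → a ≤ K * length (meet (translates x) (translates y)) → Step K
    overlap-step x y pop = record
      { g = v x ⁻¹ ∙ v y
      ; num = length L
      ; left = proj₁ ∘ in-x
      ; right = proj₁ ∘ in-y
      ; represents = λ i → begin
          v (proj₁ (in-x i))                          ≈⟨ \\-leftDividesʳ (v x) _ ⟨
          v x ⁻¹ ∙ (v x ∙ v (proj₁ (in-x i)))         ≈⟨ ∙-congˡ (mul-≡⇒≈ (≡.trans (≡.sym (proj₂ (in-x i))) (proj₂ (in-y i)))) ⟩
          v x ⁻¹ ∙ (v y ∙ v (proj₁ (in-y i)))         ≈⟨ assoc _ _ _ ⟨
          (v x ⁻¹ ∙ v y) ∙ v (proj₁ (in-y i))         ∎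
      ; left-injective = λ {i} {j} eq → lookup-injective (Unique.filter⁺ _ (translates-unique y))
          (≡.trans (proj₂ (in-x i)) (≡.trans (cong (mul x) eq) (≡.sym (proj₂ (in-x j)))))
      ; popular = pop }
      where
      L = meet (translates x) (translates y)
      in-y : ∀ i → ∃ λ q → lookup L i ≡ mul y q
      in-y i = ∈-tabulate⁻ (proj₁ (∈-filter⁻ _ {xs = translates y} (∈-lookup {xs = L} i)))
      in-x : ∀ i → ∃ λ p → lookup L i ≡ mul x p
      in-x i = ∈-tabulate⁻ (proj₂ (∈-filter⁻ _ {xs = translates y} (∈-lookup {xs = L} i)))

    -- Equally coloured elements of Aⁿ differ by D steps; this is only positive
    -- information, since equality beyond A²ⁿ need not be decidable.
    record Colouring (k D : ℕ) : Set (c Level.⊔ ℓ) where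
      field
        colour : Fin a → Fin k
        close  : ∀ i j → colour i ≡ colour j → Reach K D (v i ⁻¹ ∙ v j)

    -- The colour is the position of a popular centre. Two elements with the same centre differ by
    -- one step back to it and one step out.
    initial-colouring : Colouring (length C) 2
    initial-colouring = record
      { colour = λ x → Any.index (nearby x)
      ; close = λ i j eq → Reach-resp (begin
          (v (centre i) ⁻¹ ∙ v i) ⁻¹ ∙ (v (centre j) ⁻¹ ∙ v j)
            ≈⟨ ∙-cong (⁻¹-anti-homo-∙ _ _) (∙-congʳ (⁻¹-cong (reflexive (cong (v ∘ lookup C) (≡.sym eq))))) ⟩
          (v i ⁻¹ ∙ v (centre i) ⁻¹ ⁻¹) ∙ (v (centre i) ⁻¹ ∙ v j)
            ≈⟨ assoc _ _ _ ⟩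
          v i ⁻¹ ∙ (v (centre i) ⁻¹ ⁻¹ ∙ (v (centre i) ⁻¹ ∙ v j))
            ≈⟨ ∙-congˡ (\\-leftDividesʳ (v (centre i) ⁻¹) (v j)) ⟩
          v i ⁻¹ ∙ v j ∎)
          (Reach-∙ (Reach-step (step-⁻¹ (step i))) (Reach-step (step j))) }
      where
      nearby = λ x → popular-member centres (∈-allFin x) (length-tabulate (mul x))
      centre = λ x → lookup C (Any.index (nearby x))
      step : ∀ x → Step K
      step x = overlap-step (centre x) x (ℕP.<⇒≤ (lookup-index (nearby x)))

    -- The colour of `e` exhibits a centre.
    K>0 : 0 < K
    K>0 = positive (Colouring.colour initial-colouring e)
      where
      positive : ∀ {m} → Fin m → 0 < 2 * m
      positive {suc _} _ = s≤s z≤n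

    -- Merging colours until left translation respects the colouring.

    Violation : ∀ {k} → (Fin a → Fin k) → Set
    Violation colour = ∃ λ s → ∃₂ λ x x′ → ∃₂ λ y y′ →
      mul s x ≡ mul e x′ × mul s y ≡ mul e y′ × colour x ≡ colour y × colour x′ ≢ colour y′

    -- Stating `v s ∙ v x ≈ v x′` as an equality with `mul e x′` places it in the table, so a finite
    -- search decides it.
    violation? : ∀ {k} (colour : Fin a → Fin k) → Dec (Violation colour)
    violation? colour = any? λ s → any? λ x → any? λ x′ → any? λ y → any? λ y′ →
      (mul s x FinP.≟ mul e x′) ×-dec (mul s y FinP.≟ mul e y′) ×-dec
      (colour x FinP.≟ colour y) ×-dec ¬? (colour x′ FinP.≟ colour y′)

    mul-e : ∀ {s x x′} → mul s x ≡ mul e x′ → v s ∙ v x ≈ v x′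
    mul-e eq = trans (mul-≡⇒≈ eq) (trans (∙-congʳ (v-index (Pow-ε ε∈A n))) (identityˡ _))

    ⁻¹∙-translate : ∀ z x y → (z ∙ x) ⁻¹ ∙ (z ∙ y) ≈ x ⁻¹ ∙ y
    ⁻¹∙-translate z x y = begin
      (z ∙ x) ⁻¹ ∙ (z ∙ y)        ≈⟨ ∙-congʳ (⁻¹-anti-homo-∙ _ _) ⟩
      (x ⁻¹ ∙ z ⁻¹) ∙ (z ∙ y)     ≈⟨ assoc _ _ _ ⟩
      x ⁻¹ ∙ (z ⁻¹ ∙ (z ∙ y))     ≈⟨ ∙-congˡ (\\-leftDividesʳ z y) ⟩
      x ⁻¹ ∙ y                    ∎

    ⁻¹∙-chain : ∀ x y z → (x ⁻¹ ∙ y) ∙ (y ⁻¹ ∙ z) ≈ x ⁻¹ ∙ z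
    ⁻¹∙-chain x y z = trans (assoc _ _ _) (∙-congˡ (\\-leftDividesˡ y z))

    Reach-chain : ∀ {m m′} x y z → Reach K m (x ⁻¹ ∙ y) → Reach K m′ (y ⁻¹ ∙ z) → Reach K (m + m′) (x ⁻¹ ∙ z)
    Reach-chain x y z r r′ = Reach-resp (⁻¹∙-chain x y z) (Reach-∙ r r′)

    -- A violation shows that two colour classes are within D steps of each
    -- other, so that merging them costs a factor 3 in the diameter.
    merge : ∀ {k D} (κ : Colouring (suc k) D) → Violation (Colouring.colour κ) → Colouring k (3 * D)
    merge {k} {D} κ (s , x , x′ , y , y′ , sx , sy , x~y , x′≁y′) = record
      { colour = identify x′≁y′ ∘ colour
      ; close = λ i j eq → close′ i j (identify-fibres x′≁y′ (colour i) (colour j) eq) }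
      where
      open Colouring κ

      -- Left translation by `v s` leaves the quotient `v x ⁻¹ ∙ v y` unchanged.
      bridge : ∀ x x′ y y′ → mul s x ≡ mul e x′ → mul s y ≡ mul e y′ → colour x ≡ colour y →
               Reach K D (v x′ ⁻¹ ∙ v y′)
      bridge x x′ y y′ sx sy x~y = Reach-resp
        (trans (sym (⁻¹∙-translate (v s) (v x) (v y))) (∙-cong (⁻¹-cong (mul-e sx)) (mul-e sy)))
        (close x y x~y)

      close′ : ∀ i j → colour i ≡ colour j ⊎ (colour i ≡ colour x′ × colour j ≡ colour y′)
                                           ⊎ (colour i ≡ colour y′ × colour j ≡ colour x′) →
               Reach K (3 * D) (v i ⁻¹ ∙ v j)
      -- Elements already of one colour need `D` steps; the other `2 * D` are identity steps.
      close′ i j (inj₁ i~j) = Reach-resp (identityʳ _) (Reach-∙ (close i j i~j) (Reach-ε K>0 (2 * D)))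
      close′ i j (inj₂ (inj₁ (i~x′ , j~y′))) = Reach-chain (v i) (v x′) (v j) (close i x′ i~x′)
        (Reach-chain (v x′) (v y′) (v j) (bridge x x′ y y′ sx sy x~y)
          (subst (λ m → Reach K m _) (≡.sym (ℕP.+-identityʳ D)) (close y′ j (≡.sym j~y′))))
      close′ i j (inj₂ (inj₂ (i~y′ , j~x′))) = Reach-chain (v i) (v y′) (v j) (close i y′ i~y′)
        (Reach-chain (v y′) (v x′) (v j) (bridge y y′ x x′ sy sx (≡.sym x~y))
          (subst (λ m → Reach K m _) (≡.sym (ℕP.+-identityʳ D)) (close x′ j (≡.sym j~x′))))

    -- Each merger removes a colour and triples the diameter. A single colour admits no violation,
    -- so at most `k` mergers occur.
    stable-colouring : ∀ {k D} → Colouring (suc k) D → ∃₂ λ k′ D′ → k′ ≤ k × D′ ≤ 3 ℕ.^ k * D ×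
                       Σ (Colouring (suc k′) D′) λ κ → ¬ Violation (Colouring.colour κ)
    stable-colouring {k} {D} κ with violation? (Colouring.colour κ)
    ... | no  none = k , D , ℕP.≤-refl , ℕP.m≤n*m D (3 ℕ.^ k) ⦃ ℕP.m^n≢0 3 k ⦄ , κ , none
    stable-colouring {zero} {D} κ | yes (_ , _ , x′ , _ , y′ , _ , _ , _ , x′≁y′) =
      contradiction (Fin1 (Colouring.colour κ x′) (Colouring.colour κ y′)) x′≁y′
      where
      Fin1 : ∀ (i j : Fin 1) → i ≡ j
      Fin1 zero zero = ≡.refl
    stable-colouring {suc k} {D} κ | yes viol =
      let k′ , D′ , k′≤k , D′≤ , κ′ , none = stable-colouring (merge κ viol) in
      k′ , D′ , ℕP.m≤n⇒m≤1+n k′≤k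
      , ℕP.≤-trans D′≤ (ℕP.≤-reflexive (≡.trans (≡.sym (ℕP.*-assoc (3 ℕ.^ k) 3 D)) (cong (_* D) (ℕP.*-comm (3 ℕ.^ k) 3))))
      , κ′ , none

    -- Shortening words under a stable colouring.

    module Stable {κ D} (col : Colouring (suc κ) D) (stable : ¬ Violation (Colouring.colour col)) where
      open Colouring col using (close) renaming (colour to colourᵢ)

      colour : ∀ {x} → Pow A n x → Fin (suc κ)
      colour x∈ = colourᵢ (index x∈)

      colour-cong : ∀ {x y} (x∈ : Pow A n x) (y∈ : Pow A n y) → x ≈ y → colour x∈ ≡ colour y∈
      colour-cong x∈ y∈ x≈y =
        cong colourᵢ (v-injective (trans (v-index x∈) (trans x≈y (sym (v-index y∈)))))

      -- Stability only refutes a difference of colours; decidable equality of colours makes this an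
      -- equality.
      colour-translate : ∀ {z x y} (z∈ : Pow A n z) (x∈ : Pow A n x) (y∈ : Pow A n y)
                         (zx∈ : Pow A n (z ∙ x)) (zy∈ : Pow A n (z ∙ y)) →
                         colour x∈ ≡ colour y∈ → colour zx∈ ≡ colour zy∈
      colour-translate z∈ x∈ y∈ zx∈ zy∈ x~y = decidable-stable (_ FinP.≟ _) λ zx≁zy →
        stable (index z∈ , index x∈ , index zx∈ , index y∈ , index zy∈ ,
                mul-index z∈ x∈ zx∈ , mul-index z∈ y∈ zy∈ , x~y , zx≁zy)
        where
        mul-index : ∀ {z x} (z∈ : Pow A n z) (x∈ : Pow A n x) (zx∈ : Pow A n (z ∙ x)) →
                    mul (index z∈) (index x∈) ≡ mul e (index zx∈)
        mul-index {z} {x} z∈ x∈ zx∈ = mul-≈⇒≡ (begin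
          v (index z∈) ∙ v (index x∈)   ≈⟨ ∙-cong (v-index z∈) (v-index x∈) ⟩
          z ∙ x                         ≈⟨ identityˡ _ ⟨
          ε ∙ (z ∙ x)                   ≈⟨ ∙-cong (v-index (Pow-ε ε∈A n)) (v-index zx∈) ⟨
          v e ∙ v (index zx∈)           ∎)

      module _ (κ≤n : κ ≤ n) where

        -- Among the suffixes of a word of length j > κ two have the same colour;
        -- exchanging the longer for the shorter preserves the colour.
        shorten : ∀ {j x} → Acc _<_ j → (j≤n : j ≤ n) (x∈ : Pow A j x) →
                  ∃ λ y → Σ (Pow A κ y) λ y∈ → colour (Pow-mono ε∈A j≤n x∈) ≡ colour (Pow-mono ε∈A κ≤n y∈)
        shorten {j} {x} (acc rec) j≤n x∈ with j ≤? κ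
        ... | yes j≤κ = x , Pow-mono ε∈A j≤κ x∈ , colour-cong _ _ refl
        ... | no  j≰κ =
          -- The suffix lengths 0 to `j` are `suc j` in number, more than the `suc κ` colours. The
          -- prefix `z` belongs to the longer suffix `t′`.
          let t , t′ , t<t′ , t~t′ = pigeonhole (s≤s (ℕP.≰⇒> j≰κ)) suffix-colour
              z , y′ , z∈ , y′∈ , x≈zy′ = split t′
              _ , y , _ , y∈ , _ = split t
              l<j = shorter (toℕ≤ t′) t<t′
              l≤n = ℕP.≤-trans (ℕP.<⇒≤ l<j) j≤n
              zy∈ = Pow-∙ z∈ y∈
              u , u∈ , zy~u = shorten (rec l<j) l≤n zy∈
              zy′∈ = Pow-resp x≈zy′ (Pow-mono ε∈A j≤n x∈)
          in u , u∈ , ≡.trans (colour-cong _ zy′∈ x≈zy′)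
                     (≡.trans (colour-translate (Pow-mono ε∈A (ℕP.≤-trans (ℕP.m∸n≤m j (toℕ t′)) j≤n) z∈)
                                  (up t′ y′∈) (up t y∈) zy′∈ (Pow-mono ε∈A l≤n zy∈) (≡.sym t~t′))
                               zy~u)
          where
          toℕ≤ : ∀ (t : Fin (suc j)) → toℕ t ≤ j
          toℕ≤ t = ℕP.≤-pred (FinP.toℕ<n t)

          split : ∀ (t : Fin (suc j)) → ∃₂ λ z y → Pow A (j ∸ toℕ t) z × Pow A (toℕ t) y × x ≈ z ∙ y
          split t = Pow-split-suffix (toℕ≤ t) x∈

          up : ∀ (t : Fin (suc j)) {y} → Pow A (toℕ t) y → Pow A n y
          up t = Pow-mono ε∈A (ℕP.≤-trans (toℕ≤ t) j≤n)

          suffix-colour : Fin (suc j) → Fin (suc κ)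
          suffix-colour t = colour (up t (proj₁ (proj₂ (proj₂ (proj₂ (split t))))))

          shorter : ∀ {t t′} → t′ ≤ j → t < t′ → (j ∸ t′) + t < j
          shorter {t} {t′} t′≤j t<t′ =
            ℕP.<-≤-trans (ℕP.+-monoʳ-< (j ∸ t′) t<t′) (ℕP.≤-reflexive (ℕP.m∸n+n≡m t′≤j))

        Near : ℕ → Carrier → Set _
        Near m x = ∃ λ y → Pow A κ y × Reach K m (y ⁻¹ ∙ x)

        near-ball : ∀ {x} → Pow A n x → Near D x
        near-ball {x} x∈ =
          let y , y∈ , x~y = shorten (<-wellFounded n) ℕP.≤-refl x∈
              y∈′ = Pow-mono ε∈A κ≤n y∈
          in y , y∈ , Reach-resp (∙-cong (⁻¹-cong (v-index y∈′)) (v-index x∈))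
                       (close (index y∈′) (index x∈)
                         (≡.trans (≡.sym x~y) (colour-cong _ x∈ refl)))

        -- The last `n` letters are replaced by `κ` letters at a cost of `D` steps, which shortens
        -- the word by `r`. The untouched prefix cancels in the quotient.
        spread : ∀ r → r + κ ≡ n → ∀ t {x} → Pow A (t * r + κ) x → Near (t * D) x
        spread r r+κ≡n zero    {x} x∈ = x , x∈ , [] , inverseˡ x
        spread r r+κ≡n (suc t) {x} x∈ =
          let z , u , z∈ , u∈ , x≈zu = Pow-split (t * r) (subst (λ l → Pow A l x) lengths x∈)
              y , y∈ , y~u = near-ball u∈
              y′ , y′∈ , y′~zy = spread r r+κ≡n t (Pow-∙ z∈ y∈)
          in y′ , y′∈ , subst (λ m → Reach K m (y′ ⁻¹ ∙ x)) (ℕP.+-comm (t * D) D)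
               (Reach-resp (∙-congˡ (sym x≈zu))
                 (Reach-chain y′ (z ∙ y) (z ∙ u) y′~zy (Reach-resp (sym (⁻¹∙-translate z y u)) y~u)))
          where
          lengths : (r + t * r) + κ ≡ t * r + n
          lengths = ≡.trans (cong (_+ κ) (ℕP.+-comm r (t * r)))
                            (≡.trans (ℕP.+-assoc (t * r) r κ) (cong (t * r +_) r+κ≡n))

    -- Counting representations and covering by translates.

    module _ {K : ℕ} where

      -- Counts the choices of one representation per step together with a final element of the
      -- ball, whence the base value `a`.
      size : ∀ {m} → Vec (Step K) m → ℕ
      size []       = a
      size (h ∷ hs) = num h * size hs

      -- For x = p₀ h₁ ⋯ h_m with hᵢ = pᵢ qᵢ⁻¹ and any p in Aⁿ, the tuple
      -- (p₀ p₁ , q₁⁻¹ p₂ , … , q_m⁻¹ p) of elements of A²ⁿ has product x p.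
      tuple : ∀ {m} → Fin a → (hs : Vec (Step K) m) → Fin (size hs) → Vec (Fin b) (suc m)
      tuple p []       i = mul p i ∷ []
      tuple p (h ∷ hs) i =
        let j , i′ = remQuot (size hs) i in mul p (left h j) ∷ tuple (inv (right h j)) hs i′

      -- Since `p` is known, the first entry determines `left h j`, hence `j`, hence the starting
      -- element `inv (right h j)` of the remaining tuple.
      tuple-injective : ∀ {m} p (hs : Vec (Step K) m) {i i′} → tuple p hs i ≡ tuple p hs i′ → i ≡ i′
      tuple-injective p []       eq = mul-cancelˡ p (VecP.∷-injectiveˡ eq)
      tuple-injective p (h ∷ hs) {i} {i′} eq =
        ≡.trans (≡.sym (combine-remQuot {num h} (size hs) i))
          (≡.trans (same (remQuot (size hs) i) (remQuot (size hs) i′) eq) (combine-remQuot {num h} (size hs) i′))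
        where
        same : ∀ (x y : Fin (num h) × Fin (size hs)) →
               mul p (left h (proj₁ x)) ∷ tuple (inv (right h (proj₁ x))) hs (proj₂ x) ≡
               mul p (left h (proj₁ y)) ∷ tuple (inv (right h (proj₁ y))) hs (proj₂ y) →
               uncurry combine x ≡ uncurry combine y
        same (j , i) (j′ , i′) eq with left-injective h (mul-cancelˡ p (VecP.∷-injectiveˡ eq))
        ... | ≡.refl = cong (combine j) (tuple-injective _ hs (VecP.∷-injectiveʳ eq))

      wprod : ∀ {m} → Vec (Fin b) m → Carrier
      wprod []       = ε
      wprod (i ∷ is) = w i ∙ wprod is

      -- Inserting `v r ∙ v r ⁻¹` after each step makes the product telescope. A tuple shared by two
      -- elements therefore relates them up to final ball factors.
      tuple-prod : ∀ {m} p (hs : Vec (Step K) m) i →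
                   ∃ λ q → (v p ∙ hprod hs) ∙ v q ≈ wprod (tuple p hs i)
      tuple-prod p []       i = i , (begin
        (v p ∙ ε) ∙ v i     ≈⟨ ∙-congʳ (identityʳ _) ⟩
        v p ∙ v i           ≈⟨ w-mul p i ⟨
        w (mul p i)         ≈⟨ identityʳ _ ⟨
        w (mul p i) ∙ ε     ∎)
      tuple-prod p (h ∷ hs) i =
        let j , i′ = remQuot (size hs) i
            q , eq = tuple-prod (inv (right h j)) hs i′
            l = left h j ; r = right h j
        in q , (begin
          (v p ∙ (g h ∙ hprod hs)) ∙ v q             ≈⟨ assoc _ _ _ ⟩
          v p ∙ ((g h ∙ hprod hs) ∙ v q)             ≈⟨ ∙-congˡ (∙-congʳ (∙-congʳ (//-rightDividesʳ (v r) (g h)))) ⟨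
          v p ∙ ((((g h ∙ v r) ∙ v r ⁻¹) ∙ hprod hs) ∙ v q)
            ≈⟨ ∙-congˡ (∙-congʳ (∙-congʳ (∙-cong (sym (represents h j)) (sym (v-inv r))))) ⟩
          v p ∙ (((v l ∙ v (inv r)) ∙ hprod hs) ∙ v q)
            ≈⟨ ∙-congˡ (trans (∙-congʳ (assoc _ _ _)) (assoc _ _ _)) ⟩
          v p ∙ (v l ∙ ((v (inv r) ∙ hprod hs) ∙ v q))   ≈⟨ assoc _ _ _ ⟨
          (v p ∙ v l) ∙ ((v (inv r) ∙ hprod hs) ∙ v q)   ≈⟨ ∙-cong (sym (w-mul p l)) eq ⟩
          w (mul p l) ∙ wprod (tuple (inv r) hs i′)      ∎)

      size-lower : ∀ {m} (hs : Vec (Step K) m) → a ℕ.^ suc m ≤ size hs * K ℕ.^ m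
      size-lower []               = ℕP.≤-refl
      size-lower {suc m} (h ∷ hs) = ℕP.≤-trans (ℕP.*-mono-≤ (popular h) (size-lower hs))
                                               (ℕP.≤-reflexive (rearrange K (num h) (size hs) (K ℕ.^ m)))
        where
        rearrange : ∀ k n s l → (k * n) * (s * l) ≡ (n * s) * (k * l)
        rearrange = solve-∀

      -- Every tuple list is large enough to meet the union of the greedy family. A shared tuple
      -- gives `x i ∙ v q ≈ x (lookup X l) ∙ v q′`, so the translating factor is `v q′ ∙ v q ⁻¹`.
      -- The bound on `X` holds because only `b ℕ.^ suc m` tuples exist.
      cover : ∀ {m} {I : Set} (x : I → Carrier) (is : List I) →
              (∀ i → ∃ λ p → Σ (Vec (Step K) m) λ hs → x i ≈ v p ∙ hprod hs) →
              Σ (List I) λ X → length X * a ℕ.^ suc m ≤ b ℕ.^ suc m * K ℕ.^ m ×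
                (∀ {i} → i ∈ is → Σ (Fin (length X)) λ l → ∃ λ u → Pow A (2 * n) u × x i ≈ x (lookup X l) ∙ u)
      cover {m} {I} x is rep = X , bound , covers
        where
        origin = λ i → proj₁ (rep i)
        steps = λ i → proj₁ (proj₂ (rep i))

        tuples : I → List (Vec (Fin b) (suc m))
        tuples i = tabulate (tuple (origin i) (steps i))

        tuples-large : ∀ i → a ℕ.^ suc m ≤ length (tuples i) * K ℕ.^ m
        tuples-large i = subst (λ l → a ℕ.^ suc m ≤ l * K ℕ.^ m) (≡.sym (length-tabulate (tuple (origin i) (steps i)))) (size-lower (steps i))

        open Greedy (VecP.≡-dec FinP._≟_) tuples using (Family; greedy; meets-union)

        F : Family (K ℕ.^ m) (a ℕ.^ suc m) is
        F = greedy _ (ℕP.m^n>0 a ⦃ ℕ.>-nonZero 0<a ⦄ (suc m))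
              (λ i → Unique.tabulate⁺ (tuple-injective (origin i) (steps i))) is
        open Family F using (X; U)

        bound : length X * a ℕ.^ suc m ≤ b ℕ.^ suc m * K ℕ.^ m
        bound = ℕP.≤-trans (Family.size F)
          (ℕP.*-monoˡ-≤ (K ℕ.^ m) (length-unique-≤ encode encode-injective (Family.unique F)))

        product : ∀ {t} i → t ∈ tuples i → ∃ λ q → x i ∙ v q ≈ wprod t
        product {t} i t∈ with ∈-tabulate⁻ t∈
        ... | j , ≡.refl =
          let q , eq = tuple-prod (origin i) (steps i) j in q , trans (∙-congʳ (proj₂ (proj₂ (rep i)))) eq

        covers : ∀ {i} → i ∈ is → Σ (Fin (length X)) λ l → ∃ λ u → Pow A (2 * n) u × x i ≈ x (lookup X l) ∙ u
        covers {i} i∈ =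
          let t , t∈i , t∈U = meets-union F i∈ (tuples-large i)
              found = Family.covered F t∈U
              l = Any.index found
              q , eq = product i t∈i
              q′ , eq′ = product (lookup X l) (lookup-index found)
          in l , v q′ ∙ v q ⁻¹ , Pow-∙₂ (v∈ q′) (Pow-⁻¹ A-⁻¹ (v∈ q)) , (begin
            x i                                       ≈⟨ //-rightDividesʳ (v q) (x i) ⟨
            (x i ∙ v q) ∙ v q ⁻¹                      ≈⟨ ∙-congʳ (trans eq (sym eq′)) ⟩
            (x (lookup X l) ∙ v q′) ∙ v q ⁻¹          ≈⟨ assoc _ _ _ ⟩
            x (lookup X l) ∙ (v q′ ∙ v q ⁻¹)          ∎)

    -- Covering products of two elements of the double ball, and the size of the triple ball.

    Covers : ∀ {N} → (Fin N → Carrier) → Set _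
    Covers xs = ∀ {x y} → Pow A (2 * n) x → Pow A (2 * n) y →
                ∃₂ λ i u → Pow A (2 * n) u × x ∙ y ≈ xs i ∙ u

    cover-products : ∀ {m} → (∀ i j → ∃ λ p → Σ (Vec (Step K) m) λ hs → w i ∙ w j ≈ v p ∙ hprod hs) →
                     ∃ λ N → N * a ℕ.^ suc m ≤ b ℕ.^ suc m * K ℕ.^ m × Σ (Fin N → Carrier) Covers
    cover-products rep =
      let X , X-size , covers = cover w∙w (cartesianProduct (allFin b) (allFin b)) (uncurry rep)
      in length X , X-size , w∙w ∘ lookup X
         , λ {x} {y} x∈ y∈ →
             let i , x≈ = proj₂ (proj₂ (proj₂ cardB)) x x∈
                 j , y≈ = proj₂ (proj₂ (proj₂ cardB)) y y∈
                 l , u , u∈ , eq = covers (∈-cartesianProduct⁺ (∈-allFin i) (∈-allFin j))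
             in l , u , u∈ , trans (∙-cong x≈ y≈) eq
      where
      w∙w : Fin b × Fin b → Carrier
      w∙w (i , j) = w i ∙ w j

    represent-products : ∀ {κ D} (col : Colouring (suc κ) D) → ¬ Violation (Colouring.colour col) → 2 * κ ≤ n →
                         ∀ i j → ∃ λ p → Σ (Vec (Step K) (7 * D)) λ hs → w i ∙ w j ≈ v p ∙ hprod hs
    represent-products {κ} {D} col stable 2κ≤n i j =
      from-near (spread κ≤n (n ∸ κ) (ℕP.m∸n+n≡m κ≤n) 7 (Pow-mono ε∈A (4n≤7[n∸κ]+κ κ≤n 2κ≤n) (Pow-∙ (w∈ i) (w∈ j))))
      where
      κ≤n : κ ≤ n
      κ≤n = ℕP.≤-trans (ℕP.m≤n*m κ 2) 2κ≤n
      open Stable col stable using (Near; spread)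

      from-near : ∀ {m x} → Near κ≤n m x → ∃ λ p → Σ (Vec (Step K) m) λ hs → x ≈ v p ∙ hprod hs
      from-near (y , y∈ , hs , eq) =
        index (Pow-mono ε∈A κ≤n y∈) , hs ,
        trans (sym (\\-leftDividesˡ y _)) (∙-cong (sym (v-index (Pow-mono ε∈A κ≤n y∈))) eq)

    -- A word of length 3n splits as n + 2n; its first part is padded to length 2n so that `covers`
    -- applies. The centre and the index of the remaining factor then determine the element.
    card-tripled : ∀ {N} {xs : Fin N → Carrier} {c₃} → Covers xs → HasCard (Pow A (3 * n)) c₃ → c₃ ≤ N * b
    card-tripled {N} {xs} {c₃} covers (u , u-injective , u∈ , _) = injective⇒≤ {f = code} λ {i} {j} → code-injective i j
      where
      locate : ∀ i → ∃₂ λ (l : Fin N) (j : Fin b) → u i ≈ xs l ∙ w j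
      locate i =
        let x , y , x∈ , y∈ , u≈xy = Pow-split n (u∈ i)
            l , z , z∈ , xy≈ = covers (Pow-mono ε∈A (ℕP.m≤n*m n 2) x∈) y∈
            j , z≈ = proj₂ (proj₂ (proj₂ cardB)) z z∈
        in l , j , trans u≈xy (trans xy≈ (∙-congˡ z≈))

      code : Fin c₃ → Fin (N * b)
      code i = combine (proj₁ (locate i)) (proj₁ (proj₂ (locate i)))

      code-injective : ∀ i j → code i ≡ code j → i ≡ j
      code-injective i j eq =
        let l≡ , k≡ = combine-injective _ _ _ _ eq
        in u-injective i j (trans (proj₂ (proj₂ (locate i)))
             (trans (∙-cong (reflexive (cong xs l≡)) (reflexive (cong w k≡))) (sym (proj₂ (proj₂ (locate j))))))

    -- Here 14 is seven rounds times the initial diameter 2, the power of 3 accounts for at most `κ`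
    -- mergers, and `2 * suc κ` is the step constant for `suc κ` centres.
    CoverOfSize : ℕ → Set _
    CoverOfSize κ = ∃₂ λ m N → m ≤ 14 * 3 ℕ.^ κ ×
      N * a ℕ.^ suc m ≤ b ℕ.^ suc m * (2 * suc κ) ℕ.^ m × Σ (Fin N → Carrier) Covers

    -- `suc κ` is the number of centres. The condition `2 * κ ≤ n` stays a premise because it is
    -- derived from the rational doubling constant.
    Covering : Set _
    Covering = ∃ λ κ → suc κ * a ≤ b * 2 × (2 * κ ≤ n → CoverOfSize κ)

    covering : Covering
    covering = from-colouring (length C) ≡.refl initial-colouring
      where
      -- The number of centres is generalised to `k` so that it can be matched as `suc κ`.
      from-colouring : ∀ k → k ≡ length C → Colouring k 2 → Covering
      from-colouring zero _ col = contradiction (Colouring.colour col e) λ ()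
      from-colouring (suc κ) k≡ col =
        κ , κ-size , λ 2κ≤n →
          let κ′ , D , κ′≤κ , D≤ , col′ , stable = stable-colouring col
              N , N-size , xs , covers = cover-products
                (represent-products col′ stable (ℕP.≤-trans (ℕP.*-monoʳ-≤ 2 κ′≤κ) 2κ≤n))
          in 7 * D , N , D-bound D D≤
             , subst (λ k → N * a ℕ.^ suc (7 * D) ≤ b ℕ.^ suc (7 * D) * (2 * k) ℕ.^ (7 * D)) (≡.sym k≡) N-size
             , xs , covers
        where
        κ-size : suc κ * a ≤ b * 2
        κ-size = subst (λ k → k * a ≤ b * 2) (≡.sym k≡)
          (ℕP.≤-trans C-size (ℕP.*-monoˡ-≤ 2 (length-unique-≤ id id ∪C-unique)))

        D-bound : ∀ D → D ≤ 3 ℕ.^ κ * 2 → 7 * D ≤ 14 * 3 ℕ.^ κ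
        D-bound D D≤ = ℕP.≤-trans (ℕP.*-monoʳ-≤ 7 D≤) (ℕP.≤-reflexive (rearrange (3 ℕ.^ κ)))
          where
          rearrange : ∀ p → 7 * (p * 2) ≡ 14 * p
          rearrange = solve-∀

-- Powers and inequalities of rationals.

module Rationals where
  open import Data.Integer using (+_)
  open import Data.Nat using (z≤n; s≤s)
  open import Data.Rational using (mkℚ; 0ℚ; 1ℚ; ↥_; ↧_; ↧ₙ_; _≤_; _<_; _*_; _+_; _-_; *≤*)
  open import Relation.Binary.PropositionalEquality using (refl)
  open +-*-Solver using (solve; _:*_; _:+_; _:-_; _:=_; con)

  ℕ→ℚ-mkℚ : ∀ n → ℕ→ℚ n ≡ mkℚ (+ n) 0 (coprime-sym (1-coprimeTo n))
  ℕ→ℚ-mkℚ n = ℚP.normalize-coprime (coprime-sym (1-coprimeTo n))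

  ℕ→ℚ-mono : ∀ {m n} → m ℕ.≤ n → ℕ→ℚ m ≤ ℕ→ℚ n
  ℕ→ℚ-mono {m} {n} m≤n = subst₂ _≤_ (≡.sym (ℕ→ℚ-mkℚ m)) (≡.sym (ℕ→ℚ-mkℚ n))
    (*≤* (ℤP.*-monoʳ-≤-nonNeg (+ 1) (ℤ.+≤+ m≤n)))

  ℕ→ℚ-cancel : ∀ {m n} → ℕ→ℚ m ≤ ℕ→ℚ n → m ℕ.≤ n
  ℕ→ℚ-cancel {m} {n} le with subst₂ _≤_ (ℕ→ℚ-mkℚ m) (ℕ→ℚ-mkℚ n) le
  ... | *≤* p = ℤP.drop‿+≤+ (subst₂ ℤ._≤_ (ℤP.*-identityʳ (+ m)) (ℤP.*-identityʳ (+ n)) p)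

  ℕ→ℚ-* : ∀ m n → ℕ→ℚ (m ℕ.* n) ≡ ℕ→ℚ m * ℕ→ℚ n
  ℕ→ℚ-* m n = ≡.trans (cong (ℚ._/ 1) (ℤP.pos-* m n))
                      (≡.sym (cong₂ _*_ (ℕ→ℚ-mkℚ m) (ℕ→ℚ-mkℚ n)))

  0≤ℕ→ℚ : ∀ n → 0ℚ ≤ ℕ→ℚ n
  0≤ℕ→ℚ n = ℕ→ℚ-mono {0} {n} z≤n

  *-mono : ∀ {p q r s} → 0ℚ ≤ r → 0ℚ ≤ q → p ≤ q → r ≤ s → p * r ≤ q * s
  *-mono {q = q} {r = r} 0≤r 0≤q p≤q r≤s = ℚP.≤-trans
    (ℚP.*-monoʳ-≤-nonNeg r ⦃ ℚ.nonNegative 0≤r ⦄ p≤q)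
    (ℚP.*-monoˡ-≤-nonNeg q ⦃ ℚ.nonNegative 0≤q ⦄ r≤s)

  0≤1 : 0ℚ ≤ 1ℚ
  0≤1 = toWitness {a? = 0ℚ ℚP.≤? 1ℚ} _

  0≤* : ∀ {p q} → 0ℚ ≤ p → 0ℚ ≤ q → 0ℚ ≤ p * q
  0≤* {p} {q} 0≤p 0≤q = subst (_≤ p * q) (ℚP.*-zeroˡ 0ℚ) (*-mono ℚP.≤-refl 0≤p 0≤p 0≤q)

  1≤* : ∀ {p q} → 1ℚ ≤ p → 1ℚ ≤ q → 1ℚ ≤ p * q
  1≤* {p} {q} 1≤p 1≤q = subst (_≤ p * q) (ℚP.*-identityˡ 1ℚ) (*-mono 0≤1 (ℚP.≤-trans 0≤1 1≤p) 1≤p 1≤q)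

  0≤^ : ∀ {p} → 0ℚ ≤ p → ∀ n → 0ℚ ≤ p ^ n
  0≤^ 0≤p zero    = 0≤1
  0≤^ 0≤p (suc n) = 0≤* 0≤p (0≤^ 0≤p n)

  1≤^ : ∀ {p} → 1ℚ ≤ p → ∀ n → 1ℚ ≤ p ^ n
  1≤^ 1≤p zero    = ℚP.≤-refl
  1≤^ 1≤p (suc n) = 1≤* 1≤p (1≤^ 1≤p n)

  ^-monoˡ : ∀ {p q} → 0ℚ ≤ p → p ≤ q → ∀ n → p ^ n ≤ q ^ n
  ^-monoˡ 0≤p p≤q zero    = ℚP.≤-refl
  ^-monoˡ 0≤p p≤q (suc n) = *-mono (0≤^ 0≤p n) (ℚP.≤-trans 0≤p p≤q) p≤q (^-monoˡ 0≤p p≤q n)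

  ^-monoʳ : ∀ {p} → 1ℚ ≤ p → ∀ {m n} → m ℕ.≤ n → p ^ m ≤ p ^ n
  ^-monoʳ 1≤p {n = n} z≤n = 1≤^ 1≤p n
  ^-monoʳ {p} 1≤p (s≤s {m} m≤n) = *-mono (0≤^ 0≤p m) 0≤p ℚP.≤-refl (^-monoʳ 1≤p m≤n)
    where 0≤p = ℚP.≤-trans 0≤1 1≤p

  interchange : ∀ p q r s → (p * q) * (r * s) ≡ (p * r) * (q * s)
  interchange = solve 4 (λ p q r s → (p :* q) :* (r :* s) := (p :* r) :* (q :* s)) refl

  ^-distrib-* : ∀ p q n → (p * q) ^ n ≡ p ^ n * q ^ n
  ^-distrib-* p q zero    = ≡.sym (ℚP.*-identityˡ 1ℚ)
  ^-distrib-* p q (suc n) = ≡.trans (cong ((p * q) *_) (^-distrib-* p q n)) (interchange p q (p ^ n) (q ^ n))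

  ^-+ : ∀ p m n → p ^ (m ℕ.+ n) ≡ p ^ m * p ^ n
  ^-+ p zero    n = ≡.sym (ℚP.*-identityˡ _)
  ^-+ p (suc m) n = ≡.trans (cong (p *_) (^-+ p m n)) (≡.sym (ℚP.*-assoc p _ _))

  ^-* : ∀ p m n → p ^ (m ℕ.* n) ≡ (p ^ n) ^ m
  ^-* p zero    n = refl
  ^-* p (suc m) n = ≡.trans (^-+ p n (m ℕ.* n)) (cong (p ^ n *_) (^-* p m n))

  ℕ→ℚ-^ : ∀ m n → ℕ→ℚ (m ℕ.^ n) ≡ ℕ→ℚ m ^ n
  ℕ→ℚ-^ m zero    = refl
  ℕ→ℚ-^ m (suc n) = ≡.trans (ℕ→ℚ-* m (m ℕ.^ n)) (cong (ℕ→ℚ m *_) (ℕ→ℚ-^ m n))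

  ^-mono-< : ∀ {p q} → 0ℚ ≤ p → p < q → ∀ n → p ^ suc n < q ^ suc n
  ^-mono-< {p} {q} 0≤p p<q n = ℚP.≤-<-trans
    (ℚP.*-monoˡ-≤-nonNeg p ⦃ ℚ.nonNegative 0≤p ⦄ (^-monoˡ 0≤p (ℚP.<⇒≤ p<q) n))
    (ℚP.*-monoˡ-<-pos (q ^ n) ⦃ ℚ.positive (0<^ n) ⦄ p<q)
    where
    0<q = ℚP.≤-<-trans 0≤p p<q
    0<^ : ∀ n → 0ℚ < q ^ n
    0<^ zero    = toWitness {a? = 0ℚ ℚP.<? 1ℚ} _
    0<^ (suc n) = subst (_< q * q ^ n) (ℚP.*-zeroʳ q) (ℚP.*-monoʳ-<-pos q ⦃ ℚ.positive 0<q ⦄ (0<^ n))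

  ^-cancel-≤ : ∀ {p q} → 0ℚ ≤ q → ∀ n .⦃ _ : ℕ.NonZero n ⦄ → p ^ n ≤ q ^ n → p ≤ q
  ^-cancel-≤ {p} {q} 0≤q (suc n) p^n≤q^n = ℚP.≮⇒≥ λ q<p → ℚP.<-irrefl refl (ℚP.<-≤-trans (^-mono-< 0≤q q<p n) p^n≤q^n)

  -- Cross-multiplication, turning a rational lower bound into a comparison of natural exponents.
  numerator-bound : ∀ N {t} → 0ℚ ≤ t → ℕ→ℚ N ≤ t → ↧ₙ t ℕ.* N ℕ.≤ ℤ.∣ ↥ t ∣
  numerator-bound N {t} 0≤t N≤t with subst (_≤ t) (ℕ→ℚ-mkℚ N) N≤t
  ... | *≤* le = ℤP.drop‿+≤+ (subst₂ ℤ._≤_ (≡.trans (≡.sym (ℤP.pos-* N (↧ₙ t))) (cong +_ (ℕP.*-comm N (↧ₙ t))))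
                   (≡.trans (ℤP.*-identityʳ (↥ t)) (≡.sym (ℤP.0≤i⇒+∣i∣≡i 0≤↥t))) le)
    where
    0≤↥t : + 0 ℤ.≤ ↥ t
    0≤↥t = subst₂ ℤ._≤_ (ℤP.*-zeroˡ (↧ t)) (ℤP.*-identityʳ (↥ t)) (ℚP.drop-*≤* 0≤t)

  -- Every t ≥ e₀ 5^(K²) is at least the natural number e₀ 5^κ, so an integer
  -- exponent suffices.
  BoundLe-intro : ∀ {X c} K e₀ κ → 0ℚ ≤ X → 0ℚ ≤ c → 1ℚ ≤ base K → ℕ→ℚ κ ≤ K * K →
                  X ≤ c * base K ^ (e₀ ℕ.* 5 ℕ.^ κ) → BoundLe X c e₀ K
  BoundLe-intro {X} {c} K e₀ κ 0≤X 0≤c 1≤B κ≤K² X≤ t (0≤t , t-large) = begin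
    X ^ d                           ≤⟨ ^-monoˡ 0≤X X≤ d ⟩
    (c * B ^ M) ^ d                 ≡⟨ ^-distrib-* c (B ^ M) d ⟩
    c ^ d * (B ^ M) ^ d             ≡⟨ cong (c ^ d *_) (^-* B d M) ⟨
    c ^ d * B ^ (d ℕ.* M)           ≤⟨ ℚP.*-monoˡ-≤-nonNeg (c ^ d) ⦃ ℚ.nonNegative (0≤^ 0≤c d) ⦄
                                         (^-monoʳ 1≤B (numerator-bound M 0≤t M≤t)) ⟩
    c ^ d * B ^ ℤ.∣ ↥ t ∣           ∎
    where
    open ℚP.≤-Reasoning
    B = base K
    M = e₀ ℕ.* 5 ℕ.^ κ
    d = ↧ₙ t
    s = K * K
    β = ↧ₙ s

    -- The hypothesis bounds `t ^ β`, with `β` the denominator of K², so `β`-th powers are compared.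
    M≤t : ℕ→ℚ M ≤ t
    M≤t = ^-cancel-≤ 0≤t β (begin
      ℕ→ℚ M ^ β                             ≡⟨ cong (_^ β) (≡.trans (ℕ→ℚ-* e₀ (5 ℕ.^ κ)) (cong (ℕ→ℚ e₀ *_) (ℕ→ℚ-^ 5 κ))) ⟩
      (ℕ→ℚ e₀ * ℕ→ℚ 5 ^ κ) ^ β              ≡⟨ ^-distrib-* (ℕ→ℚ e₀) _ β ⟩
      ℕ→ℚ e₀ ^ β * (ℕ→ℚ 5 ^ κ) ^ β          ≡⟨ cong (ℕ→ℚ e₀ ^ β *_) (^-* (ℕ→ℚ 5) β κ) ⟨
      ℕ→ℚ e₀ ^ β * ℕ→ℚ 5 ^ (β ℕ.* κ)        ≤⟨ ℚP.*-monoˡ-≤-nonNeg (ℕ→ℚ e₀ ^ β) ⦃ ℚ.nonNegative (0≤^ (0≤ℕ→ℚ e₀) β) ⦄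
                                                 (^-monoʳ (ℕ→ℚ-mono {1} {5} (s≤s z≤n)) (numerator-bound κ (ℚP.≤-trans (0≤ℕ→ℚ κ) κ≤K²) κ≤K²)) ⟩
      ℕ→ℚ e₀ ^ β * ℕ→ℚ 5 ^ ℤ.∣ ↥ s ∣        ≤⟨ t-large ⟩
      t ^ β                                 ∎)

  -- Numerical estimates in terms of the doubling constant.

  module Bounds {K : ℚ} (1≤K : 1ℚ ≤ K) where
    open ℚP.≤-Reasoning

    0≤K : 0ℚ ≤ K
    0≤K = ℚP.≤-trans 0≤1 1≤K

    -- 4K², the cost of one step
    Z : ℚ
    Z = K * (ℕ→ℚ 2 * (ℕ→ℚ 2 * K))

    1≤2 : 1ℚ ≤ ℕ→ℚ 2
    1≤2 = ℕ→ℚ-mono {1} {2} (s≤s z≤n)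

    1≤Z : 1ℚ ≤ Z
    1≤Z = 1≤* 1≤K (1≤* 1≤2 (1≤* 1≤2 1≤K))

    -- The square is 2⁴K⁴. Using it rather than `Z` lets the exponent of `Z` be twice that of
    -- `base K`.
    Z²≤base : Z * Z ≤ base K
    Z²≤base = begin
      Z * Z                       ≡⟨ rearrange K (ℕ→ℚ 2) ⟩
      (ℕ→ℚ 2 ^ 4) * (K ^ 4)       ≤⟨ *-mono (0≤^ 0≤K 4) (0≤^ (0≤ℕ→ℚ 3) 9)
                                       (ℚP.≤-trans (^-monoʳ 1≤2 {4} {9} (s≤s (s≤s (s≤s (s≤s z≤n)))))
                                                   (^-monoˡ (0≤ℕ→ℚ 2) (ℕ→ℚ-mono {2} {3} (s≤s (s≤s z≤n))) 9))
                                       (^-monoʳ 1≤K {4} {18} (s≤s (s≤s (s≤s (s≤s z≤n))))) ⟩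
      base K                      ∎
      where
      rearrange : ∀ K t → (K * (t * (t * K))) * (K * (t * (t * K))) ≡ t ^ 4 * K ^ 4
      rearrange = solve 2 (λ K t →
        (K :* (t :* (t :* K))) :* (K :* (t :* (t :* K))) :=
        (t :* (t :* (t :* (t :* con 1ℚ)))) :* (K :* (K :* (K :* (K :* con 1ℚ))))) refl

    1≤base : 1ℚ ≤ base K
    1≤base = ℚP.≤-trans (1≤* 1≤Z 1≤Z) Z²≤base

    Z^≤base^ : ∀ m M → m ℕ.≤ M ℕ.* 2 → Z ^ m ≤ base K ^ M
    Z^≤base^ m M m≤2M = begin
      Z ^ m             ≤⟨ ^-monoʳ 1≤Z m≤2M ⟩
      Z ^ (M ℕ.* 2)     ≡⟨ ^-* Z M 2 ⟩
      (Z ^ 2) ^ M       ≡⟨ cong (λ z → (Z * z) ^ M) (ℚP.*-identityʳ Z) ⟩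
      (Z * Z) ^ M       ≤⟨ ^-monoˡ (ℚP.≤-trans 0≤1 (1≤* 1≤Z 1≤Z)) Z²≤base M ⟩
      base K ^ M        ∎

    module _ (a b : ℕ) (0<a : 0 ℕ.< a) (b≤Ka : ℕ→ℚ b ≤ K * ℕ→ℚ a) where

      0<a^ : ∀ m → ℚ.Positive (ℕ→ℚ (a ℕ.^ m))
      0<a^ m = ℚ.positive (ℚP.<-≤-trans (toWitness {a? = 0ℚ ℚP.<? 1ℚ} _)
                 (ℕ→ℚ-mono {1} (ℕP.m^n>0 a ⦃ ℕ.>-nonZero 0<a ⦄ m)))

      doubling⇒k≤2K : ∀ k → k ℕ.* a ℕ.≤ b ℕ.* 2 → ℕ→ℚ k ≤ ℕ→ℚ 2 * K
      doubling⇒k≤2K k ka≤2b = ℚP.*-cancelʳ-≤-pos (ℕ→ℚ a) ⦃ subst (λ x → ℚ.Positive (ℕ→ℚ x)) (ℕP.*-identityʳ a) (0<a^ 1) ⦄ (begin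
        ℕ→ℚ k * ℕ→ℚ a           ≡⟨ ℕ→ℚ-* k a ⟨
        ℕ→ℚ (k ℕ.* a)           ≤⟨ ℕ→ℚ-mono ka≤2b ⟩
        ℕ→ℚ (b ℕ.* 2)           ≡⟨ ℕ→ℚ-* b 2 ⟩
        ℕ→ℚ b * ℕ→ℚ 2           ≤⟨ ℚP.*-monoʳ-≤-nonNeg (ℕ→ℚ 2) b≤Ka ⟩
        (K * ℕ→ℚ a) * ℕ→ℚ 2     ≡⟨ ℚP.*-comm (K * ℕ→ℚ a) (ℕ→ℚ 2) ⟩
        ℕ→ℚ 2 * (K * ℕ→ℚ a)     ≡⟨ ℚP.*-assoc (ℕ→ℚ 2) K (ℕ→ℚ a) ⟨
        (ℕ→ℚ 2 * K) * ℕ→ℚ a     ∎)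

      -- Dividing by the power of `a` leaves at most K^(m+1) (4K)^m, which is K (4K²)^m.
      covering-bound : ∀ k m N → ℕ→ℚ k ≤ ℕ→ℚ 2 * K →
                       N ℕ.* a ℕ.^ suc m ℕ.≤ b ℕ.^ suc m ℕ.* (2 ℕ.* k) ℕ.^ m → ℕ→ℚ N ≤ K * Z ^ m
      covering-bound k m N k≤2K size = ℚP.*-cancelʳ-≤-pos (ℕ→ℚ (a ℕ.^ suc m)) ⦃ 0<a^ (suc m) ⦄ (begin
        ℕ→ℚ N * ℕ→ℚ (a ℕ.^ suc m)                     ≡⟨ ℕ→ℚ-* N _ ⟨
        ℕ→ℚ (N ℕ.* a ℕ.^ suc m)                       ≤⟨ ℕ→ℚ-mono size ⟩
        ℕ→ℚ (b ℕ.^ suc m ℕ.* (2 ℕ.* k) ℕ.^ m)         ≡⟨ ℕ→ℚ-* (b ℕ.^ suc m) _ ⟩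
        ℕ→ℚ (b ℕ.^ suc m) * ℕ→ℚ ((2 ℕ.* k) ℕ.^ m)     ≡⟨ cong₂ _*_ (ℕ→ℚ-^ b (suc m)) (ℕ→ℚ-^ (2 ℕ.* k) m) ⟩
        ℕ→ℚ b ^ suc m * ℕ→ℚ (2 ℕ.* k) ^ m             ≤⟨ *-mono (0≤^ (0≤ℕ→ℚ (2 ℕ.* k)) m) (0≤^ (0≤* 0≤K (0≤ℕ→ℚ a)) (suc m))
                                                            (^-monoˡ (0≤ℕ→ℚ b) b≤Ka (suc m)) (^-monoˡ (0≤ℕ→ℚ (2 ℕ.* k)) 2k≤4K m) ⟩
        (K * ℕ→ℚ a) ^ suc m * 4K ^ m                  ≡⟨ cong (_* 4K ^ m) (^-distrib-* K (ℕ→ℚ a) (suc m)) ⟩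
        ((K * K ^ m) * ℕ→ℚ a ^ suc m) * 4K ^ m        ≡⟨ rearrange K (K ^ m) (ℕ→ℚ a ^ suc m) (4K ^ m) ⟩
        (K * (K ^ m * 4K ^ m)) * ℕ→ℚ a ^ suc m        ≡⟨ cong₂ (λ x y → (K * x) * y) (^-distrib-* K 4K m) (ℕ→ℚ-^ a (suc m)) ⟨
        (K * Z ^ m) * ℕ→ℚ (a ℕ.^ suc m)               ∎)
        where
        4K = ℕ→ℚ 2 * (ℕ→ℚ 2 * K)
        2k≤4K : ℕ→ℚ (2 ℕ.* k) ≤ 4K
        2k≤4K = subst (_≤ 4K) (≡.sym (ℕ→ℚ-* 2 k)) (ℚP.*-monoˡ-≤-nonNeg (ℕ→ℚ 2) k≤2K)
        rearrange : ∀ p q r s → ((p * q) * r) * s ≡ (p * (q * s)) * r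
        rearrange = solve 4 (λ p q r s → ((p :* q) :* r) :* s := (p :* (q :* s)) :* r) refl

    -- From `κ ≤ 2K - 1` and `(K - 1)² ≥ 0`.
    κ≤K² : ∀ κ → ℕ→ℚ (suc κ) ≤ ℕ→ℚ 2 * K → ℕ→ℚ κ ≤ K * K
    κ≤K² κ κ+1≤2K = begin
      ℕ→ℚ κ                                  ≡⟨ shift (ℕ→ℚ κ) ⟩
      (1ℚ + ℕ→ℚ κ) - 1ℚ                      ≡⟨ cong (_- 1ℚ) (ℕ→ℚ-suc κ) ⟨
      ℕ→ℚ (suc κ) - 1ℚ                       ≤⟨ ℚP.+-monoˡ-≤ (ℚ.- 1ℚ) κ+1≤2K ⟩
      (1ℚ + 1ℚ) * K - 1ℚ                     ≡⟨ ℚP.+-identityˡ _ ⟨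
      0ℚ + ((1ℚ + 1ℚ) * K - 1ℚ)              ≤⟨ ℚP.+-monoˡ-≤ _ (0≤* 0≤K-1 0≤K-1) ⟩
      (K - 1ℚ) * (K - 1ℚ) + ((1ℚ + 1ℚ) * K - 1ℚ)   ≡⟨ square K ⟩
      K * K                                  ∎
      where
      ℕ→ℚ-suc : ∀ n → ℕ→ℚ (suc n) ≡ 1ℚ + ℕ→ℚ n
      ℕ→ℚ-suc n = ≡.trans (cong (ℚ._/ 1) (cong (λ x → + 1 ℤ.+ x) (≡.sym (ℤP.*-identityʳ (+ n)))))
                          (cong (_+_ 1ℚ) (≡.sym (ℕ→ℚ-mkℚ n)))
      shift : ∀ x → x ≡ (1ℚ + x) - 1ℚ
      shift = solve 1 (λ x → x := (con 1ℚ :+ x) :- con 1ℚ) refl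
      square : ∀ K → (K - 1ℚ) * (K - 1ℚ) + ((1ℚ + 1ℚ) * K - 1ℚ) ≡ K * K
      square = solve 1 (λ K → (K :- con 1ℚ) :* (K :- con 1ℚ) :+ ((con 1ℚ :+ con 1ℚ) :* K :- con 1ℚ) := K :* K) refl
      0≤K-1 : 0ℚ ≤ K - 1ℚ
      0≤K-1 = ℚP.+-monoˡ-≤ (ℚ.- 1ℚ) 1≤K

    tripling-bound : ∀ a b c N M → ℕ→ℚ b ≤ K * ℕ→ℚ a → ℕ→ℚ N ≤ K * base K ^ M → c ℕ.≤ N ℕ.* b →
                     ℕ→ℚ c ≤ (K ^ 3 * ℕ→ℚ a) * base K ^ M
    tripling-bound a b c N M b≤Ka N≤ c≤Nb = begin
      ℕ→ℚ c                             ≤⟨ ℕ→ℚ-mono c≤Nb ⟩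
      ℕ→ℚ (N ℕ.* b)                     ≡⟨ ℕ→ℚ-* N b ⟩
      ℕ→ℚ N * ℕ→ℚ b                     ≤⟨ *-mono (0≤ℕ→ℚ b) (0≤* 0≤K 0≤B^M) N≤ b≤Ka ⟩
      (K * base K ^ M) * (K * ℕ→ℚ a)    ≡⟨ rearrange K (base K ^ M) (ℕ→ℚ a) ⟩
      (K ^ 2 * ℕ→ℚ a) * base K ^ M      ≤⟨ *-mono 0≤B^M (0≤* (0≤^ 0≤K 3) (0≤ℕ→ℚ a))
                                             (*-mono (0≤ℕ→ℚ a) (0≤^ 0≤K 3) (^-monoʳ 1≤K {2} {3} (s≤s (s≤s z≤n))) ℚP.≤-refl)
                                             ℚP.≤-refl ⟩
      (K ^ 3 * ℕ→ℚ a) * base K ^ M      ∎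
      where
      0≤B^M = 0≤^ (ℚP.≤-trans 0≤1 1≤base) M
      rearrange : ∀ K x a → (K * x) * (K * a) ≡ (K ^ 2 * a) * x
      rearrange = solve 3 (λ K x a → (K :* x) :* (K :* a) := ((K :* (K :* con 1ℚ)) :* a) :* x) refl

    weaken-bound : ∀ {x} M M′ → M ℕ.≤ M′ → x ≤ K * base K ^ M → x ≤ K ^ 9 * base K ^ M′
    weaken-bound {x} M M′ M≤M′ x≤ = begin
      x                         ≤⟨ x≤ ⟩
      K * base K ^ M            ≡⟨ cong (_* base K ^ M) (ℚP.*-identityʳ K) ⟨
      K ^ 1 * base K ^ M        ≤⟨ *-mono (0≤^ (ℚP.≤-trans 0≤1 1≤base) M) (0≤^ 0≤K 9)
                                     (^-monoʳ 1≤K {1} {9} (s≤s z≤n)) (^-monoʳ 1≤base M≤M′) ⟩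
      K ^ 9 * base K ^ M′       ∎

-- Assembly of the two conclusions from one cover.

open import Algebra.Bundles using (Group)
open import Data.Nat using (ℕ)
open import Data.Rational using (ℚ; 1ℚ; _≤_; _*_)
open import Data.List using (List)
open import Data.Product using (_×_)

theorem1p4 : ∀ {c ℓ} (G : Group c ℓ) (K : ℚ) → 1ℚ ≤ K →
    (S : List (Group.Carrier G)) →
    GroupDefs.Symmetric G (GroupDefs.InList G S) →
    GroupDefs.InList G S (Group.ε G) →
    (n : ℕ) → (ℕ→ℚ 2 * K) * K ≤ ℕ→ℚ n →
    (a b : ℕ) →
    GroupDefs.HasCard G (GroupDefs.Pow G (GroupDefs.InList G S) n) a →
    GroupDefs.HasCard G (GroupDefs.Pow G (GroupDefs.InList G S) (2 Data.Nat.* n)) b →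
    ℕ→ℚ b ≤ K * ℕ→ℚ a →
    ((c₃ : ℕ) →
    GroupDefs.HasCard G (GroupDefs.Pow G (GroupDefs.InList G S) (3 Data.Nat.* n)) c₃ →
    BoundLe (ℕ→ℚ c₃) ((K ^ 3) * ℕ→ℚ a) 10 K)
    ×
    GroupDefs.IsApproxGroup G (GroupDefs.Pow G (GroupDefs.InList G S) (2 Data.Nat.* n))
    (λ k → BoundLe (ℕ→ℚ k) (K ^ 9) 30 K)
theorem1p4 G K 1≤K S S-sym ε∈S n 2K²≤n a b cardₙ card₂ₙ b≤Ka = conclude covering
  where
  open Group G using (Carrier; _⁻¹; refl; sym; trans; ∙-congˡ; identityʳ)
  open GroupDefs G using (InList; HasCard; Pow; IsApproxGroup)
  open Rationals
  open Bounds 1≤K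

  S⁻¹⊆S : ∀ {x} → InList S x → InList S (x ⁻¹)
  S⁻¹⊆S {x} x∈ = proj₂ (S-sym (x ⁻¹)) (x , x∈ , refl)

  open Growth.Words G (InList S) using (Pow-symmetric; Pow-ε)
  open Growth.Ball G (InList S) S⁻¹⊆S ε∈S n a b cardₙ card₂ₙ using (Covering; CoverOfSize; Covers; covering; card-tripled; 0<a)

  Goal = ((c₃ : ℕ) → HasCard (Pow (InList S) (3 ℕ.* n)) c₃ → BoundLe (ℕ→ℚ c₃) ((K ^ 3) * ℕ→ℚ a) 10 K)
       × IsApproxGroup (Pow (InList S) (2 ℕ.* n)) (λ k → BoundLe (ℕ→ℚ k) (K ^ 9) 30 K)

  conclude-with : ∀ κ → ℕ→ℚ κ ≤ K * K → ∀ N → ℕ→ℚ N ≤ K * base K ^ (10 ℕ.* 5 ℕ.^ κ) →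
                  (xs : Fin N → Carrier) → Covers xs → Goal
  conclude-with κ κ≤ N N≤ xs covers =
    (λ c₃ card₃ₙ → BoundLe-intro K 10 κ (0≤ℕ→ℚ c₃) (0≤* (0≤^ 0≤K 3) (0≤ℕ→ℚ a)) 1≤base κ≤
      (tripling-bound a b c₃ N (10 ℕ.* 5 ℕ.^ κ) b≤Ka N≤ (card-tripled covers card₃ₙ)))
    , Pow-symmetric S⁻¹⊆S (2 ℕ.* n)
    , Pow-ε ε∈S (2 ℕ.* n)
    , N
    , BoundLe-intro K 30 κ (0≤ℕ→ℚ N) (0≤^ 0≤K 9) 1≤base κ≤
        (weaken-bound (10 ℕ.* 5 ℕ.^ κ) (30 ℕ.* 5 ℕ.^ κ) (ℕP.*-monoˡ-≤ (5 ℕ.^ κ) {10} {30} (ℕP.m≤m+n 10 20)) N≤)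
    , xs
    -- A product of two factors ends in `ε`, which `identityʳ` removes.
    , λ { y (s , s∈ , eq) →
          let i , u , u∈ , eq′ = covers (s∈ zero) (s∈ (suc zero))
          in i , u , u∈ , trans (sym eq) (trans (∙-congˡ (identityʳ _)) eq′) }

  conclude : Covering → Goal
  conclude (κ , κ-size , cover) = from-cover (cover 2κ≤n)
    where
    κ+1≤2K : ℕ→ℚ (suc κ) ≤ ℕ→ℚ 2 * K
    κ+1≤2K = doubling⇒k≤2K a b 0<a b≤Ka (suc κ) κ-size

    -- The assumption on `n` enters here, through `κ ≤ K²`.
    2κ≤n : 2 ℕ.* κ ℕ.≤ n
    2κ≤n = ℕ→ℚ-cancel {2 ℕ.* κ} {n} (begin
      ℕ→ℚ (2 ℕ.* κ)         ≡⟨ ℕ→ℚ-* 2 κ ⟩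
      ℕ→ℚ 2 * ℕ→ℚ κ         ≤⟨ ℚP.*-monoˡ-≤-nonNeg (ℕ→ℚ 2) (κ≤K² κ κ+1≤2K) ⟩
      ℕ→ℚ 2 * (K * K)       ≡⟨ ℚP.*-assoc (ℕ→ℚ 2) K K ⟨
      (ℕ→ℚ 2 * K) * K       ≤⟨ 2K²≤n ⟩
      ℕ→ℚ n                 ∎)
      where open ℚP.≤-Reasoning

    from-cover : CoverOfSize κ → Goal
    from-cover (m , N , m≤ , N-size , xs , covers) = conclude-with κ (κ≤K² κ κ+1≤2K) N
      (ℚP.≤-trans (covering-bound a b 0<a b≤Ka (suc κ) m N κ+1≤2K N-size)
                  (ℚP.*-monoˡ-≤-nonNeg K ⦃ ℚ.nonNegative 0≤K ⦄ (Z^≤base^ m (10 ℕ.* 5 ℕ.^ κ) m≤20·5^κ)))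
      xs covers
      where
      -- The factor 2 from `Z²≤base` matters: for `κ = 0` the bound 14 exceeds 10 but not 20.
      m≤20·5^κ : m ℕ.≤ (10 ℕ.* 5 ℕ.^ κ) ℕ.* 2
      m≤20·5^κ = begin
        m                              ≤⟨ m≤ ⟩
        14 ℕ.* 3 ℕ.^ κ                 ≤⟨ ℕP.*-mono-≤ {14} {20} (ℕP.m≤m+n 14 6) (ℕP.^-monoˡ-≤ κ (ℕP.m≤m+n 3 2)) ⟩
        2 ℕ.* 10 ℕ.* 5 ℕ.^ κ           ≡⟨ ℕP.*-assoc 2 10 (5 ℕ.^ κ) ⟩
        2 ℕ.* (10 ℕ.* 5 ℕ.^ κ)         ≡⟨ ℕP.*-comm 2 (10 ℕ.* 5 ℕ.^ κ) ⟩
        (10 ℕ.* 5 ℕ.^ κ) ℕ.* 2         ∎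
        where open ℕP.≤-Reasoning
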